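{- Let $P=[\widehat{0},\widehat{1}]$ be a graded dual simplicial Eulerian poset of rank $n+1$, and let $(h_0,\ldots,h_n)$ be the toric $h$-vector of $(P\setminus\{\widehat{0}\})^*$. Then \begin{align*} \operatorname{t}([\widehat{0},\widehat{1}),x)&=h_0 \left(t_n(x)-(n-1)t_{n-2}(x)\right)\\ &\quad+\sum_{i=1}^{n-1} h_i \sum_{k=1}^{\left\lfloor n/2\right\rfloor} \left(\binom{n-i}{k}\binom{i-1}{k-1}-\binom{n-i-1}{k}\binom{i}{k-1}\right) t_{n-2k}(x). \end{align*}
   Context: A graded poset is a finite poset with a unique minimum $\widehat{0}$, a unique maximum $\widehat{1}$ and a rank function $\rho:P\to\mathbb{N}$ with $\rho(\widehat{0})=0$ and $\rho(y)=\rho(x)+1$ whenever $y$ covers $x$; its rank is $\rho(\widehat{1})$. It is Eulerian if $\sum_{z\in[u,v]}(-1)^{\rho(z)}=0$ for all $u<v$. It is dual simplicial if for every $t\neq\widehat{0}$ the interval $[t,\widehat{1}]$ is a Boolean algebra. $Q^*$ denotes the dual (order-reversed) poset of $Q$. Write $[\widehat{0},p)=\{q: q<p\}$. Stanley's toric polynomials: $f(\emptyset,x)=g(\emptyset,x)=1$ ($\emptyset$ being $[\widehat{0},\widehat{1})$ for the Eulerian poset of rank $0$), and for an Eulerian poset of rank at least $1$, $$f([\widehat{0},\widehat{1}),x)=\sum_{p\in[\widehat{0},\widehat{1})} g([\widehat{0},p),x)(x-1)^{\rho(\widehat{1})-1-\rho(p)},$$ $$g([\widehat{0},\widehat{1}),x)=\sum_{i=0}^{\lfloor(\rho(\widehat{1})-1)/2\rfloor}\left([x^i]f([\widehat{0},\widehat{1}),x)-[x^{i-1}]f([\widehat{0},\widehat{1}),x)\right)x^i.$$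 By a theorem of Stanley, if the rank is $n+1$ then $f([\widehat{0},\widehat{1}),x)$ has degree $n$ and satisfies $x^nf([\widehat{0},\widehat{1}),1/x)=f([\widehat{0},\widehat{1}),x)$. Toric $h$-vector: for an Eulerian poset $Q$ of rank $n+1$, the toric $h$-vector $(h_0,\dots,h_n)$ of $Q\setminus\{\widehat{1}_Q\}$ is defined by $\sum_i h_ix^i=x^nf(Q\setminus\{\widehat{1}_Q\},1/x)$ (which equals $f(Q\setminus\{\widehat{1}_Q\},x)$). Here it is applied to $Q=P^*$, whose maximum is $\widehat{0}$, so $Q\setminus\{\widehat 1_Q\}=(P\setminus\{\widehat{0}\})^*$; explicitly $h_k=\sum_{i=k}^n(-1)^{i-k}\binom{i}{k}f_i(P)$, where $f_i(P)$ is the number of elements of rank $i+1$ in $P$. Short toric polynomial: for an Eulerian poset of rank $n+1$, $\operatorname{t}([\widehat{0},\widehat{1}),x)$ is the unique polynomial $q(x)$ of degree $n$ with $q(x)=(-1)^nq(-x)$ and $f([\widehat{0},\widehat{1}),x)=x^{n/2}\left(q(\sqrt{x})+q(1/\sqrt{x})-q(0)\right)$; equivalently, it is obtained from $x^{n}f([\widehat{0},\widehat{1}),x^{ -2})$ by discarding all terms of negative degree. $t_m(x)$ denotes the short toric polynomial of the Boolean algebra of rank $m+1$ (with its maximum removed); explicitly $t_m(x)=\sum_{k=0}^{\lfloor m/2\rfloor}x^{m-2k}$ for $m\geq0$. Convention: $t_m(x)=0$ for $m<0$. -}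

module Defs where

import Data.Bool.Properties as Bool
open import Data.Bool.Base using (Bool; if_then_else_)
open import Data.Empty using (⊥-elim)
open import Data.Fin.Base as Fin using (Fin; toℕ; fromℕ<)
open import Data.Fin.Induction using (po-wellFounded; po-noetherian)
import Data.Fin.Properties as Fin
open import Data.Fin.Properties using (any?; 2↔Bool; *↔×)
open import Data.Fin.Subset as Subset
  using (Subset; ∣_∣; _∈_; _⊆_; _∪_; ⁅_⁆; inside; outside)
open import Data.Fin.Subset.Properties
  using (⊆-isPartialOrder; ⊆-min; ⊆-max; ⊆-antisym; _⊆?_; _∈?_;
         ∣⊥∣≡0; x∈p∪q⁻; x∈p∪q⁺; p⊆p∪q; x∈⁅x⁆; x∈⁅y⁆⇒x≡y; ∪-identityʳ)
open import Data.Integer.Base as ℤ using (ℤ; +_; -[1+_]; 0ℤ; 1ℤ; -1ℤ)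
import Data.Integer.Properties as ℤ
open import Data.Nat.Base as ℕ using (ℕ; zero; suc; _∸_; ⌊_/2⌋)
import Data.Nat.Properties as ℕ
open import Data.Product.Base using (Σ-syntax; ∃-syntax; _×_; _,_; proj₁; proj₂)
open import Data.Product.Function.NonDependent.Propositional using (_×-↔_)
open import Data.Sum.Base using (_⊎_; inj₁; inj₂; [_,_]′)
import Data.Vec.Base as Vec
open import Data.Vec.Base using ([]; _∷_)
import Data.Vec.Properties as Vec
open import Function.Base using (_∘_; _on_; flip)
open import Function.Bundles using (_↔_; Inverse; mk↔ₛ′)
open import Function.Construct.Composition using (_↔-∘_)
open import Induction.WellFounded using (Acc; acc; WellFounded; module Subrelation)
open import Level using (0ℓ)
open import Relation.Binary.Bundles using (Poset)
open import Relation.Binary.Core using (Rel)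
open import Relation.Binary.Definitions using (Decidable; Minimum; Maximum)
open import Relation.Binary.Structures using (IsPartialOrder; IsDecPartialOrder)
import Relation.Binary.Construct.Flip.EqAndOrd as Flip
import Relation.Binary.Construct.NonStrictToStrict as NonStrictToStrict
import Relation.Binary.Construct.On as On
open import Relation.Binary.Morphism.Structures using (IsOrderIsomorphism)
open import Relation.Binary.PropositionalEquality
  using (_≡_; _≢_; _≗_; refl; sym; trans; cong; cong₂; subst; subst₂;
         module ≡-Reasoning)
open import Relation.Nullary.Decidable using (Dec; yes; no; ¬?; _×-dec_)
open import Relation.Nullary.Negation using (¬_; contradiction)

open import Algebra.Properties.Monoid.Sum ℤ.+-0-monoid using (sum; sum-cong-≗)

------------------------------------------------------------------------
-- Polynomials

-- A polynomial in ℤ[x] is given by its sequence of coefficients.  Every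
-- operation below preserves finite support, and two polynomials are equal
-- when their coefficients agree (_≗_).

Poly : Set
Poly = ℕ → ℤ

infixl 6 _⊕_ _⊖_
infixl 7 _⊛_
infixr 8 _·_
infixr 9 X^_

0ₚ : Poly
0ₚ _ = 0ℤ

X^_ : ℕ → Poly
(X^ i) k = if i ℕ.≡ᵇ k then 1ℤ else 0ℤ

1ₚ : Poly
1ₚ = X^ 0

_⊕_ _⊖_ _⊛_ : Poly → Poly → Poly
(p ⊕ q) k = p k ℤ.+ q k
(p ⊖ q) k = p k ℤ.- q k
(p ⊛ q) k = sum λ (i : Fin (suc k)) → p (toℕ i) ℤ.* q (k ∸ toℕ i)

_·_ : ℤ → Poly → Poly
(c · p) k = c ℤ.* p k

[X-1]^_ : ℕ → Poly
[X-1]^ zero  = 1ₚ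
[X-1]^ suc d = (X^ 1 ⊖ 1ₚ) ⊛ [X-1]^ d

-- The sum of F i over a ≤ i ≤ b, which is empty when b < a.

sumₚ : ℕ → ℕ → (ℕ → Poly) → Poly
sumₚ a b F k = sum λ (i : Fin (suc b ∸ a)) → F (a ℕ.+ toℕ i) k

infixr 7 sumₚ
syntax sumₚ a b (λ i → p) = ∑[ i ∈ a ⋯ b ] p

-- xⁿ p(1/x), for p of degree at most n.

reverse : ℕ → Poly → Poly
reverse n p = ∑[ j ∈ 0 ⋯ n ] p j · X^ (n ∸ j)

⊛-congʳ : ∀ {p p′} q → p ≗ p′ → p ⊛ q ≗ p′ ⊛ q
⊛-congʳ q p≗p′ k = sum-cong-≗ λ (i : Fin (suc k)) → cong (ℤ._* q (k ∸ toℕ i)) (p≗p′ (toℕ i))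

------------------------------------------------------------------------
-- Graded posets

when : {A : Set} → Dec A → (A → ℤ) → ℤ
when (yes a) z = z a
when (no _)  z = 0ℤ

record GradedPoset : Set₁ where
  infix 4 _≤_ _<_ _⋖_ _<?_
  field
    Carrier           : Set
    _≤_               : Rel Carrier 0ℓ
    isDecPartialOrder : IsDecPartialOrder _≡_ _≤_
    size              : ℕ
    finite            : Fin size ↔ Carrier
    0̂ 1̂               : Carrier
    0̂-minimum         : Minimum _≤_ 0̂
    1̂-maximum         : Maximum _≤_ 1̂

  open IsDecPartialOrder isDecPartialOrder public
    using (_≤?_; _≟_; isPartialOrder)
    renaming (refl to ≤-refl; trans to ≤-trans; antisym to ≤-antisym)

  _<_ : Rel Carrier 0ℓ
  _<_ = NonStrictToStrict._<_ _≡_ _≤_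

  _<?_ : Decidable _<_
  _<?_ = NonStrictToStrict.<-decidable _≡_ _≤_ _≟_ _≤?_

  _⋖_ : Rel Carrier 0ℓ
  x ⋖ y = x < y × (∀ z → ¬ (x < z × z < y))

  field
    ρ   : Carrier → ℕ
    ρ-0̂ : ρ 0̂ ≡ 0
    ρ-⋖ : ∀ {x y} → x ⋖ y → ρ y ≡ suc (ρ x)

  rank : ℕ
  rank = ρ 1̂

  element : Fin size → Carrier
  element = Inverse.to finite

  index : Carrier → Fin size
  index = Inverse.from finite

  element-index : ∀ x → element (index x) ≡ x
  element-index = Inverse.strictlyInverseˡ finite

  -- The sum of F x over the elements x satisfying a decidable predicate.
  -- The summand may use the proof that x satisfies the predicate.

  ∑[_]_ : {Q : Carrier → Set} → (∀ x → Dec (Q x)) → (∀ x → Q x → ℤ) → ℤ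
  ∑[ Q? ] F = sum λ i → when (Q? (element i)) (F (element i))

  isPO : IsPartialOrder (_≡_ on element) (_≤_ on element)
  isPO = On.isPartialOrder element isPartialOrder

  on-index : ∀ {x y} → x < y → element (index x) < element (index y)
  on-index = subst₂ _<_ (sym (element-index _)) (sym (element-index _))

  <-wellFounded : WellFounded _<_
  <-wellFounded =
    Subrelation.wellFounded on-index (On.wellFounded index (po-wellFounded isPO))

  >-wellFounded : WellFounded (flip _<_)
  >-wellFounded =
    Subrelation.wellFounded on-index (On.wellFounded index (po-noetherian isPO))

  between? : ∀ x y → Dec (∃[ i ] (x < element i × element i < y))
  between? x y = any? λ i → (x <? element i) ×-dec (element i <? y)

  ρ-mono-< : ∀ {x y} → x < y → ρ x ℕ.< ρ y
  ρ-mono-< {x} {y} = go (<-wellFounded y) (>-wellFounded x)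
    where
    go : ∀ {x y} → Acc _<_ y → Acc (flip _<_) x → x < y → ρ x ℕ.< ρ y
    go {x} {y} (acc ys) (acc xs) x<y with between? x y
    ... | yes (i , x<z , z<y) =
      ℕ.<-trans (go (ys z<y) (acc xs) x<z) (go (acc ys) (xs x<z) z<y)
    ... | no none = ℕ.≤-reflexive (sym (ρ-⋖ (x<y , λ z (x<z , z<y) →
      none (index z , subst (λ w → x < w × w < y) (sym (element-index z)) (x<z , z<y)))))

  ρ≤rank : ∀ x → ρ x ℕ.≤ rank
  ρ≤rank x with x ≟ 1̂
  ... | yes refl = ℕ.≤-refl
  ... | no x≢1̂   = ℕ.<⇒≤ (ρ-mono-< (1̂-maximum x , x≢1̂))

dual : GradedPoset → GradedPoset
dual P = record
  { Carrier           = Carrier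
  ; _≤_               = flip _≤_
  ; isDecPartialOrder = record
      { isPartialOrder = Flip.isPartialOrder isPartialOrder ; _≟_ = _≟_ ; _≤?_ = flip _≤?_ }
  ; size              = size
  ; finite            = finite
  ; 0̂                 = 1̂
  ; 1̂                 = 0̂
  ; 0̂-minimum         = 1̂-maximum
  ; 1̂-maximum         = 0̂-minimum
  ; ρ                 = λ x → rank ∸ ρ x
  ; ρ-0̂               = ℕ.n∸n≡0 rank
  ; ρ-⋖               = rank∸ρ-⋖
  }
  where
  open GradedPoset P

  rank∸ρ-⋖ : ∀ {x y} →
             (y ≤ x × ¬ x ≡ y) × (∀ z → ¬ ((z ≤ x × ¬ x ≡ z) × (y ≤ z × ¬ z ≡ y))) →
             rank ∸ ρ y ≡ suc (rank ∸ ρ x)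
  rank∸ρ-⋖ {x} {y} ((y≤x , x≢y) , none) =
    trans (ℕ.+-∸-assoc 1 {rank} {suc (ρ y)} (subst (ℕ._≤ rank) ρx≡1+ρy (ρ≤rank x)))
          (cong (λ r → suc (rank ∸ r)) (sym ρx≡1+ρy))
    where
    ρx≡1+ρy : ρ x ≡ suc (ρ y)
    ρx≡1+ρy = ρ-⋖ ((y≤x , x≢y ∘ sym) , λ z ((y≤z , y≢z) , (z≤x , z≢x)) →
      none z ((z≤x , z≢x ∘ sym) , (y≤z , y≢z ∘ sym)))

------------------------------------------------------------------------
-- Boolean algebras

×↔∷ : ∀ {m} → (Bool × Subset m) ↔ Subset (suc m)
×↔∷ = mk↔ₛ′ (λ sp → proj₁ sp ∷ proj₂ sp) (λ p → Vec.head p , Vec.tail p)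
            (λ { (s ∷ p) → refl }) (λ _ → refl)

Subset↔ : ∀ m → Fin (2 ℕ.^ m) ↔ Subset m
Subset↔ zero    = mk↔ₛ′ (λ _ → []) (λ _ → Fin.zero) (λ { [] → refl })
                        (λ { Fin.zero → refl ; (Fin.suc ()) })
Subset↔ (suc m) = ×↔∷ ↔-∘ ((2↔Bool ×-↔ Subset↔ m) ↔-∘ *↔×)

∣p∪⁅x⁆∣ : ∀ {m} (p : Subset m) x → ¬ x ∈ p → ∣ p ∪ ⁅ x ⁆ ∣ ≡ suc ∣ p ∣
∣p∪⁅x⁆∣ (inside  ∷ p) Fin.zero    x∉p = ⊥-elim (x∉p Vec.here)
∣p∪⁅x⁆∣ (outside ∷ p) Fin.zero    x∉p = cong (suc ∘ ∣_∣) (∪-identityʳ p)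
∣p∪⁅x⁆∣ (inside  ∷ p) (Fin.suc x) x∉p = cong suc (∣p∪⁅x⁆∣ p x (x∉p ∘ Vec.there))
∣p∪⁅x⁆∣ (outside ∷ p) (Fin.suc x) x∉p = ∣p∪⁅x⁆∣ p x (x∉p ∘ Vec.there)

boolean : ℕ → GradedPoset
boolean m = record
  { Carrier           = Subset m
  ; _≤_               = _⊆_
  ; isDecPartialOrder = record
      { isPartialOrder = ⊆-isPartialOrder m ; _≟_ = _≟_ ; _≤?_ = _⊆?_ }
  ; size              = 2 ℕ.^ m
  ; finite            = Subset↔ m
  ; 0̂                 = Subset.⊥
  ; 1̂                 = Subset.⊤
  ; 0̂-minimum         = ⊆-min
  ; 1̂-maximum         = ⊆-max
  ; ρ                 = ∣_∣
  ; ρ-0̂               = ∣⊥∣≡0 m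
  ; ρ-⋖               = λ {p} {q} → ∣∣-⋖ p q
  }
  where
  _≟_ : Decidable {A = Subset m} _≡_
  _≟_ = Vec.≡-dec Bool._≟_

  ∣∣-⋖ : ∀ (p q : Subset m) →
         (p ⊆ q × ¬ p ≡ q) × (∀ r → ¬ ((p ⊆ r × ¬ p ≡ r) × (r ⊆ q × ¬ r ≡ q))) →
         ∣ q ∣ ≡ suc ∣ p ∣
  ∣∣-⋖ p q ((p⊆q , p≢q) , none) with any? (λ x → (x ∈? q) ×-dec ¬? (x ∈? p))
  ... | no q∖p-empty = contradiction (⊆-antisym p⊆q q⊆p) p≢q
    where
    q⊆p : q ⊆ p
    q⊆p {x} x∈q with x ∈? p
    ... | yes x∈p = x∈p
    ... | no  x∉p = contradiction (x , x∈q , x∉p) q∖p-empty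
  ... | yes (x , x∈q , x∉p) with (p ∪ ⁅ x ⁆) ≟ q
  ...   | yes refl = ∣p∪⁅x⁆∣ p x x∉p
  ...   | no  r≢q  = ⊥-elim (none (p ∪ ⁅ x ⁆) ((p⊆p∪q ⁅ x ⁆ , p≢r) , (r⊆q , r≢q)))
    where
    p≢r : ¬ p ≡ p ∪ ⁅ x ⁆
    p≢r p≡r = x∉p (subst (x ∈_) (sym p≡r) (x∈p∪q⁺ (inj₂ (x∈⁅x⁆ x))))

    r⊆q : p ∪ ⁅ x ⁆ ⊆ q
    r⊆q y∈r = [ p⊆q , (λ y∈⁅x⁆ → subst (_∈ q) (sym (x∈⁅y⁆⇒x≡y x y∈⁅x⁆)) x∈q) ]′
              (x∈p∪q⁻ p ⁅ x ⁆ y∈r)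

-- A finite Boolean algebra is a poset isomorphic to the subsets of some
-- finite set.

IsBooleanAlgebra : Poset 0ℓ 0ℓ 0ℓ → Set
IsBooleanAlgebra Q =
  ∃[ m ] Σ[ φ ∈ (Poset.Carrier Q → Subset m) ]
    IsOrderIsomorphism (Poset._≈_ Q) _≡_ (Poset._≤_ Q) _⊆_ φ

------------------------------------------------------------------------
-- Eulerian and dual simplicial posets

module _ (P : GradedPoset) where
  open GradedPoset P

  -- Elements of an interval are compared by their first components, so
  -- the proofs of membership play no role.

  interval : Carrier → Carrier → Poset 0ℓ 0ℓ 0ℓ
  interval u v = record
    { Carrier        = ∃[ z ] (u ≤ z × z ≤ v)
    ; _≈_            = _≡_ on proj₁
    ; _≤_            = _≤_ on proj₁
    ; isPartialOrder = On.isPartialOrder proj₁ isPartialOrder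
    }

  Eulerian : Set
  Eulerian = ∀ u v → u < v →
    ∑[ (λ z → (u ≤? z) ×-dec (z ≤? v)) ] (λ z _ → -1ℤ ℤ.^ ρ z) ≡ 0ℤ

  DualSimplicial : Set
  DualSimplicial = ∀ t → ¬ t ≡ 0̂ → IsBooleanAlgebra (interval t 1̂)

------------------------------------------------------------------------
-- Toric polynomials

-- The coefficient of xⁱ⁻¹, which is 0 for i = 0.

coeff-below : Poly → ℕ → ℤ
coeff-below f zero    = 0ℤ
coeff-below f (suc i) = f i

-- g obtained from f, for a poset of the given rank.

stanleyG : ℕ → Poly → Poly
stanleyG zero    f = 1ₚ
stanleyG (suc d) f = ∑[ i ∈ 0 ⋯ ⌊ d /2⌋ ] (f i ℤ.- coeff-below f i) · X^ i

stanleyG-cong : ∀ r {f f′} → f ≗ f′ → stanleyG r f ≗ stanleyG r f′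
stanleyG-cong zero    f≗f′ k = refl
stanleyG-cong (suc d) {f} {f′} f≗f′ k =
  sum-cong-≗ λ (i : Fin (suc ⌊ d /2⌋)) →
    cong (ℤ._* (X^ toℕ i) k) (cong₂ ℤ._-_ (f≗f′ (toℕ i)) (below (toℕ i)))
  where
  below : ∀ i → coeff-below f i ≡ coeff-below f′ i
  below zero    = refl
  below (suc i) = f≗f′ i

module _ (P : GradedPoset) where
  open GradedPoset P

  -- f([0̂,p)) obtained from the polynomials g([0̂,q)) for q < p, where r is
  -- the rank of p.

  stanleyF : (r : ℕ) (p : Carrier) → (∀ q → q < p → Poly) → Poly
  stanleyF zero    p g   = 1ₚ
  stanleyF (suc d) p g k =
    ∑[ _<? p ] λ q q<p → (g q q<p ⊛ [X-1]^ (d ∸ ρ q)) k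

  gAcc : ∀ p → Acc _<_ p → Poly
  gAcc p (acc rs) = stanleyG (ρ p) (stanleyF (ρ p) p λ q q<p → gAcc q (rs q<p))

  -- toricF p and toricG p are f([0̂,p)) and g([0̂,p)).

  toricG : Carrier → Poly
  toricG p = gAcc p (<-wellFounded p)

  toricF : Carrier → Poly
  toricF p = stanleyF (ρ p) p λ q _ → toricG q

  -- The definition of toricF is Stanley's formula for f; toricG-unfold is
  -- his formula for g.

  stanleyF-cong : ∀ r p {g g′ : ∀ q → q < p → Poly} →
                  (∀ q q<p → g q q<p ≗ g′ q q<p) → stanleyF r p g ≗ stanleyF r p g′
  stanleyF-cong zero    p g≗g′ k = refl
  stanleyF-cong (suc d) p {g} {g′} g≗g′ k = sum-cong-≗ λ i → same (element i) (element i <? p)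
    where
    same : ∀ q (q<p? : Dec (q < p)) →
           when q<p? (λ q<p → (g q q<p ⊛ [X-1]^ (d ∸ ρ q)) k) ≡
           when q<p? (λ q<p → (g′ q q<p ⊛ [X-1]^ (d ∸ ρ q)) k)
    same q (yes q<p) = ⊛-congʳ ([X-1]^ (d ∸ ρ q)) (g≗g′ q q<p) k
    same q (no _)    = refl

  gAcc-irrelevant : ∀ p (a a′ : Acc _<_ p) → gAcc p a ≗ gAcc p a′
  gAcc-irrelevant p (acc rs) (acc rs′) =
    stanleyG-cong (ρ p) (stanleyF-cong (ρ p) p λ q q<p → gAcc-irrelevant q (rs q<p) (rs′ q<p))

  toricG-unfold : ∀ p → toricG p ≗ stanleyG (ρ p) (toricF p)
  toricG-unfold p with <-wellFounded p
  ... | acc rs =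
    stanleyG-cong (ρ p) (stanleyF-cong (ρ p) p λ q q<p → gAcc-irrelevant q (rs q<p) (<-wellFounded q))

-- For Q of rank n + 1, the entry h_k (0 ≤ k ≤ n) of the toric h-vector of
-- Q ∖ {1̂}.

toricH : GradedPoset → ℕ → ℤ
toricH Q = reverse (rank ∸ 1) (toricF Q 1̂)
  where open GradedPoset Q

------------------------------------------------------------------------
-- The short toric polynomial

-- The terms of nonnegative degree of xⁿ f(x⁻²).  By short-unique below, this
-- is the polynomial q determined by q(x) = (-1)ⁿ q(-x) and
-- f(x) = x^(n/2) (q(√x) + q(1/√x) - q(0)) whenever such a q exists.

short : ℕ → Poly → Poly
short n f = ∑[ j ∈ 0 ⋯ ⌊ n /2⌋ ] f j · X^ (n ∸ 2 ℕ.* j)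

shortToric : GradedPoset → Poly
shortToric P = short (rank ∸ 1) (toricF P 1̂)
  where open GradedPoset P

-- t m is 0 for m < 0.

t : ℤ → Poly
t (+ m)    = shortToric (boolean (suc m))
t -[1+ _ ] = 0ₚ

------------------------------------------------------------------------
-- The functional equation of the short toric polynomial

-- f(x²).

square : Poly → Poly
square f zero          = f 0
square f (suc zero)    = 0ℤ
square f (suc (suc k)) = square (f ∘ suc) k

-- The conditions q(x) = (-1)ⁿ q(-x) and f(x) = x^(n/2) (q(√x) + q(1/√x) - q(0))
-- on a polynomial q of degree at most n, the latter with x² substituted for x.

record IsShort (n : ℕ) (f q : Poly) : Set where
  field
    degree   : ∀ k → n ℕ.< k → q k ≡ 0ℤ
    parity   : ∀ k → q k ≡ -1ℤ ℤ.^ n ℤ.* (-1ℤ ℤ.^ k ℤ.* q k)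
    equation : square f ≗ X^ n ⊛ q ⊕ reverse n q ⊖ q 0 · X^ n

sum-zero : ∀ {m} {F : Fin m → ℤ} → (∀ i → F i ≡ 0ℤ) → sum F ≡ 0ℤ
sum-zero {zero}  F≡0 = refl
sum-zero {suc m} F≡0 = cong₂ ℤ._+_ (F≡0 Fin.zero) (sum-zero (F≡0 ∘ Fin.suc))

sum-single : ∀ {m} {F : Fin m → ℤ} i → (∀ j → j ≢ i → F j ≡ 0ℤ) → sum F ≡ F i
sum-single {suc m} {F} Fin.zero    F≡0 =
  trans (cong (λ s → F Fin.zero ℤ.+ s) (sum-zero λ j → F≡0 (Fin.suc j) λ ())) (ℤ.+-identityʳ _)
sum-single {suc m} (Fin.suc i) F≡0 =
  trans (cong₂ ℤ._+_ (F≡0 Fin.zero λ ()) (sum-single i λ j j≢i → F≡0 (Fin.suc j) (j≢i ∘ Fin.suc-injective)))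
        (ℤ.+-identityˡ _)

X^-≡ : ∀ i → (X^ i) i ≡ 1ℤ
X^-≡ zero    = refl
X^-≡ (suc i) = X^-≡ i

X^-≢ : ∀ i k → i ≢ k → (X^ i) k ≡ 0ℤ
X^-≢ zero    zero    i≢k = contradiction refl i≢k
X^-≢ zero    (suc k) i≢k = refl
X^-≢ (suc i) zero    i≢k = refl
X^-≢ (suc i) (suc k) i≢k = X^-≢ i k (i≢k ∘ cong suc)

monomials-∉ : ∀ b (c : ℕ → ℤ) (e : ℕ → ℕ) k → (∀ j → j ℕ.≤ b → e j ≢ k) →
              (∑[ j ∈ 0 ⋯ b ] c j · X^ (e j)) k ≡ 0ℤ
monomials-∉ b c e k e≢k = sum-zero λ i →
  trans (cong (c (toℕ i) ℤ.*_) (X^-≢ (e (toℕ i)) k (e≢k (toℕ i) (ℕ.≤-pred (Fin.toℕ<n i)))))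
        (ℤ.*-zeroʳ (c (toℕ i)))

monomials-∈ : ∀ b (c : ℕ → ℤ) (e : ℕ → ℕ) i → i ℕ.≤ b → (∀ j → j ℕ.≤ b → e j ≡ e i → j ≡ i) →
              (∑[ j ∈ 0 ⋯ b ] c j · X^ (e j)) (e i) ≡ c i
monomials-∈ b c e i i≤b inj =
  trans (sum-single {F = F} (fromℕ< (ℕ.s≤s i≤b)) off)
        (trans (cong G (Fin.toℕ-fromℕ< (ℕ.s≤s i≤b)))
               (trans (cong (c i ℤ.*_) (X^-≡ (e i))) (ℤ.*-identityʳ (c i))))
  where
  G : ℕ → ℤ
  G j = c j ℤ.* (X^ (e j)) (e i)

  F : Fin (suc b) → ℤ
  F = G ∘ toℕ

  off : ∀ j → j ≢ fromℕ< (ℕ.s≤s i≤b) → F j ≡ 0ℤ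
  off j j≢i = trans (cong (c (toℕ j) ℤ.*_) (X^-≢ (e (toℕ j)) (e i) λ ej≡ei →
      j≢i (Fin.toℕ-injective (trans (inj (toℕ j) (ℕ.≤-pred (Fin.toℕ<n j)) ej≡ei)
                                    (sym (Fin.toℕ-fromℕ< (ℕ.s≤s i≤b)))))))
    (ℤ.*-zeroʳ (c (toℕ j)))

reverse-coeff : ∀ n q j → j ℕ.≤ n → reverse n q (n ∸ j) ≡ q j
reverse-coeff n q j j≤n = monomials-∈ n q (n ∸_) j j≤n λ i i≤n → ℕ.∸-cancelˡ-≡ i≤n j≤n

2*≤ : ∀ n j → j ℕ.≤ ⌊ n /2⌋ → 2 ℕ.* j ℕ.≤ n
2*≤ n j j≤ = ℕ.≤-trans (ℕ.*-monoʳ-≤ 2 j≤)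
  (ℕ.≤-trans (ℕ.≤-reflexive (cong (⌊ n /2⌋ ℕ.+_) (ℕ.+-identityʳ _)))
  (ℕ.≤-trans (ℕ.+-monoʳ-≤ ⌊ n /2⌋ (ℕ.⌊n/2⌋≤⌈n/2⌉ n)) (ℕ.≤-reflexive (ℕ.⌊n/2⌋+⌈n/2⌉≡n n))))

short-coeff : ∀ n f j → j ℕ.≤ ⌊ n /2⌋ → short n f (n ∸ 2 ℕ.* j) ≡ f j
short-coeff n f j j≤ = monomials-∈ ⌊ n /2⌋ f (λ j → n ∸ 2 ℕ.* j) j j≤ λ i i≤ eq →
  ℕ.*-cancelˡ-≡ i j 2 (ℕ.∸-cancelˡ-≡ (2*≤ n i i≤) (2*≤ n j j≤) eq)

shift-coeff-≡ : ∀ n q → (X^ n ⊛ q) n ≡ q 0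
shift-coeff-≡ n q = trans (sum-single {F = F} (Fin.fromℕ n) off) at
  where
  F : Fin (suc n) → ℤ
  F i = (X^ n) (toℕ i) ℤ.* q (n ∸ toℕ i)
  off : ∀ j → j ≢ Fin.fromℕ n → F j ≡ 0ℤ
  off j j≢n = cong (ℤ._* q (n ∸ toℕ j)) (X^-≢ n (toℕ j) λ n≡j →
    j≢n (Fin.toℕ-injective (trans (sym n≡j) (sym (Fin.toℕ-fromℕ n)))))
  at : F (Fin.fromℕ n) ≡ q 0
  at rewrite Fin.toℕ-fromℕ n | X^-≡ n | ℕ.n∸n≡0 n = ℤ.*-identityˡ (q 0)

shift-coeff-< : ∀ n q k → k ℕ.< n → (X^ n ⊛ q) k ≡ 0ℤ
shift-coeff-< n q k k<n = sum-zero λ i → cong (ℤ._* q (k ∸ toℕ i))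
  (X^-≢ n (toℕ i) λ n≡i → ℕ.<-irrefl (sym n≡i) (ℕ.<-≤-trans (Fin.toℕ<n i) k<n))

square-even : ∀ f j → square f (2 ℕ.* j) ≡ f j
square-even f zero    = refl
square-even f (suc j) rewrite ℕ.+-suc j (j ℕ.+ 0) = square-even (f ∘ suc) j

even⊎odd : ∀ d → (∃[ j ] d ≡ 2 ℕ.* j) ⊎ (∃[ j ] d ≡ suc (2 ℕ.* j))
even⊎odd zero    = inj₁ (0 , refl)
even⊎odd (suc d) with even⊎odd d
... | inj₁ (j , refl) = inj₂ (j , refl)
... | inj₂ (j , refl) = inj₁ (suc j , cong suc (sym (ℕ.+-suc j (j ℕ.+ 0))))

-1^2j : ∀ j → -1ℤ ℤ.^ (2 ℕ.* j) ≡ 1ℤ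
-1^2j j = trans (sym (ℤ.^-*-assoc -1ℤ 2 j)) (ℤ.^-zeroˡ j)

i≡-i⇒i≡0 : ∀ i → i ≡ ℤ.- i → i ≡ 0ℤ
i≡-i⇒i≡0 (+ zero) _ = refl

≤⌊/2⌋ : ∀ n j → 2 ℕ.* j ℕ.≤ n → j ℕ.≤ ⌊ n /2⌋
≤⌊/2⌋ n j 2j≤n = ℕ.≤-trans (ℕ.≤-reflexive (trans (ℕ.n≡⌊n+n/2⌋ j) (cong (λ i → ⌊ j ℕ.+ i /2⌋) (sym (ℕ.+-identityʳ j)))))
  (ℕ.⌊n/2⌋-mono 2j≤n)

-- short n f is the only polynomial that can satisfy these conditions.

short-unique : ∀ {n f q} → IsShort n f q → q ≗ short n f
short-unique {n} {f} {q} isShort k with k ℕ.≤? n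
... | no k≰n = trans (degree k (ℕ.≰⇒> k≰n)) (sym (monomials-∉ ⌊ n /2⌋ f (λ j → n ∸ 2 ℕ.* j) k
        λ j _ eq → k≰n (subst (ℕ._≤ n) eq (ℕ.m∸n≤m n (2 ℕ.* j)))))
  where open IsShort isShort
... | yes k≤n with even⊎odd (n ∸ k)
...   | inj₂ (j , n∸k≡1+2j) = trans (i≡-i⇒i≡0 (q k) qk≡-qk) (sym (monomials-∉ ⌊ n /2⌋ f (λ j → n ∸ 2 ℕ.* j) k
        λ i i≤ eq → ℕ.even≢odd i j (trans (sym (ℕ.m∸[m∸n]≡n (2*≤ n i i≤))) (trans (cong (n ∸_) eq) n∸k≡1+2j))))
  where
  open IsShort isShort
  open ≡-Reasoning
  qk≡-qk : q k ≡ ℤ.- q k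
  qk≡-qk = begin
    q k                                                        ≡⟨ parity k ⟩
    -1ℤ ℤ.^ n ℤ.* (-1ℤ ℤ.^ k ℤ.* q k)                          ≡⟨ ℤ.*-assoc (-1ℤ ℤ.^ n) (-1ℤ ℤ.^ k) (q k) ⟨
    -1ℤ ℤ.^ n ℤ.* -1ℤ ℤ.^ k ℤ.* q k                            ≡⟨ cong (ℤ._* q k) (ℤ.^-distribˡ-+-* -1ℤ n k) ⟨
    -1ℤ ℤ.^ (n ℕ.+ k) ℤ.* q k                                  ≡⟨ cong (λ m → -1ℤ ℤ.^ m ℤ.* q k) n+k≡ ⟩
    -1ℤ ℤ.^ suc (2 ℕ.* (j ℕ.+ k)) ℤ.* q k                      ≡⟨ cong (λ s → -1ℤ ℤ.* s ℤ.* q k) (-1^2j (j ℕ.+ k)) ⟩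
    -1ℤ ℤ.* q k                                                ≡⟨ ℤ.-1*i≡-i (q k) ⟩
    ℤ.- q k                                                    ∎
    where
    n+k≡ : n ℕ.+ k ≡ suc (2 ℕ.* (j ℕ.+ k))
    n+k≡ = begin
      n ℕ.+ k                      ≡⟨ cong (ℕ._+ k) (ℕ.m∸n+n≡m k≤n) ⟨
      n ∸ k ℕ.+ k ℕ.+ k            ≡⟨ cong (λ d → d ℕ.+ k ℕ.+ k) n∸k≡1+2j ⟩
      suc (2 ℕ.* j ℕ.+ k ℕ.+ k)    ≡⟨ cong suc (ℕ.+-assoc (2 ℕ.* j) k k) ⟩
      suc (2 ℕ.* j ℕ.+ (k ℕ.+ k))  ≡⟨ cong (λ m → suc (2 ℕ.* j ℕ.+ (k ℕ.+ m))) (ℕ.+-identityʳ k) ⟨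
      suc (2 ℕ.* j ℕ.+ 2 ℕ.* k)    ≡⟨ cong suc (ℕ.*-distribˡ-+ 2 j k) ⟨
      suc (2 ℕ.* (j ℕ.+ k))        ∎
...   | inj₁ (j , n∸k≡2j) = begin
    q k                    ≡⟨ cong q k≡ ⟩
    q (n ∸ 2 ℕ.* j)        ≡⟨ at (ℕ.m≤n⇒m<n∨m≡n 2j≤n) ⟨
    square f (2 ℕ.* j)     ≡⟨ square-even f j ⟩
    f j                    ≡⟨ short-coeff n f j (≤⌊/2⌋ n j 2j≤n) ⟨
    short n f (n ∸ 2 ℕ.* j) ≡⟨ cong (short n f) k≡ ⟨
    short n f k            ∎
  where
  open IsShort isShort
  open ≡-Reasoning
  2j≤n : 2 ℕ.* j ℕ.≤ n
  2j≤n = subst (ℕ._≤ n) n∸k≡2j (ℕ.m∸n≤m n k)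
  k≡ : k ≡ n ∸ 2 ℕ.* j
  k≡ = trans (sym (ℕ.m∸[m∸n]≡n k≤n)) (cong (n ∸_) n∸k≡2j)
  rev≡ : reverse n q (2 ℕ.* j) ≡ q (n ∸ 2 ℕ.* j)
  rev≡ = trans (cong (reverse n q) (sym (ℕ.m∸[m∸n]≡n 2j≤n))) (reverse-coeff n q (n ∸ 2 ℕ.* j) (ℕ.m∸n≤m n (2 ℕ.* j)))
  at : 2 ℕ.* j ℕ.< n ⊎ 2 ℕ.* j ≡ n → square f (2 ℕ.* j) ≡ q (n ∸ 2 ℕ.* j)
  at (inj₁ 2j<n) = trans (equation (2 ℕ.* j)) (trans (cong₂ ℤ._-_
    (cong₂ ℤ._+_ (shift-coeff-< n q (2 ℕ.* j) 2j<n) rev≡)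
    (trans (cong (q 0 ℤ.*_) (X^-≢ n (2 ℕ.* j) (ℕ.<⇒≢ 2j<n ∘ sym))) (ℤ.*-zeroʳ (q 0))))
    (trans (ℤ.+-identityʳ _) (ℤ.+-identityˡ _)))
  at (inj₂ 2j≡n) = trans (equation (2 ℕ.* j)) (trans (cong₂ ℤ._-_
    (cong₂ ℤ._+_ (trans (cong (X^ n ⊛ q) 2j≡n) (shift-coeff-≡ n q)) rev≡)
    (trans (cong (q 0 ℤ.*_) (trans (cong (X^ n) 2j≡n) (X^-≡ n))) (ℤ.*-identityʳ (q 0))))
    (trans (cong (ℤ._- q 0) (ℤ.+-comm (q 0) (q (n ∸ 2 ℕ.* j)))) (trans (ℤ.+-assoc (q (n ∸ 2 ℕ.* j)) (q 0) (ℤ.- q 0))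
      (trans (cong (λ z → q (n ∸ 2 ℕ.* j) ℤ.+ z) (ℤ.+-inverseʳ (q 0))) (ℤ.+-identityʳ _)))))

-- Write D for multiplication by x - 1.  By Stanley's recursion the polynomials
-- g([0̂,p)) are characterised by deg g([0̂,p)) < ρ(p)/2 and the vanishing of
-- ∑_{q ≤ p} D^(ρ(p)-ρ(q)) g([0̂,q)) in degrees below ρ(p)/2.  When P is dual
-- simplicial, this is solved for p ≠ 0̂ by
--
--   ∑_{0̂ ≠ s ≤ p} (-1)^ρ(s) γ_s,
--
-- where γ_s is the part of degree below ρ(s)/2 of (x - 1) H_s and
-- H_s = ∑_{0̂ ≠ q ≤ s} (x - 1)^(ρ(q)-1) is the h-polynomial of the dual of
-- [0̂,s].  Indeed [s,p] is Boolean for s ≠ 0̂, so that summing D^(ρ(p)-ρ(q)) over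
-- s ≤ q ≤ p gives x^(ρ(p)-ρ(s)).  The coefficients of g([0̂,1̂)) thus become
-- truncated alternating sums over the f-vector of P; rewritten in terms of
-- H = ∑ H_l x^l they are
--
--   g_k = ∑_l H_l (C(l,k) C(n-l-1,k-1) - C(l,k-1) C(n-l-1,k))
--
-- for k ≥ 1.  Since h_l = H_(n-l) by definition and H_l = H_(n-l) by the
-- Dehn–Sommerville equations, the first product yields the first product of the
-- theorem and the second one the second.  Finally g_k is the coefficient of
-- t_(n-2k) in the short toric polynomial.

module Submission where

open import Defs
open import Data.Integer.Base using (+_; _-_; _*_)
open import Data.Nat.Base using (ℕ; suc; _∸_; ⌊_/2⌋)
open import Data.Nat.Combinatorics using (_C_)
open import Relation.Binary.PropositionalEquality using (_≡_; _≗_)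

open import Data.Fin.Base as Fin using (Fin; toℕ; fromℕ<)
import Data.Fin.Properties as Fin
open import Data.Fin.Subset as Subset using (Subset; ∣_∣; _⊆_; inside; outside)
open import Data.Fin.Subset.Properties using (_⊆?_; drop-∷-⊆; out⊆; in⊆in; ⊥⊆; ∣⊥∣≡0; ∣⊤∣≡n)
open import Data.Integer.Base using (ℤ; -_; _+_; _^_; 0ℤ; 1ℤ; -1ℤ)
import Data.Integer.Properties as ℤ
open import Data.Integer.Tactic.RingSolver using (solve-∀)
open import Data.Nat.Base as ℕ using (zero)
open import Data.Nat.Combinatorics using (nC1≡n; k>n⇒nCk≡0; nCk+nC[k+1]≡[n+1]C[k+1])
import Data.Nat.Properties as ℕ
open import Data.Product.Base using (_×_; _,_; proj₁; proj₂; ∃-syntax)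
open import Data.Sum.Base using (_⊎_; inj₁; inj₂)
open import Data.Unit.Base using (⊤; tt)
open import Data.Vec.Base using ([]; _∷_)
open import Function.Base using (_∘_; _$_; id)
open import Function.Bundles using (Inverse)
open import Induction.WellFounded using (Acc; acc)
open import Relation.Binary.Morphism.Structures using (IsOrderIsomorphism)
open import Relation.Binary.PropositionalEquality
  using (_≢_; refl; sym; trans; cong; cong₂; subst; subst₂; module ≡-Reasoning)
open import Relation.Nullary.Decidable using (Dec; yes; no; ¬?; _×-dec_)
open import Relation.Nullary.Negation using (¬_; contradiction)

open import Algebra.Properties.Semiring.Sum ℤ.+-*-semiring
  using (sum; sum-cong-≗; ∑-distrib-+; ∑-comm; *-distribˡ-sum)
open ≡-Reasoning

-- Indicators and finite sums

⟦_⟧ : {A : Set} → Dec A → ℤ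
⟦ yes _ ⟧ = 1ℤ
⟦ no _ ⟧  = 0ℤ

⟦⟧-yes : {A : Set} (a? : Dec A) → A → ⟦ a? ⟧ ≡ 1ℤ
⟦⟧-yes (yes _) a = refl
⟦⟧-yes (no ¬a) a = contradiction a ¬a

⟦⟧-no : {A : Set} (a? : Dec A) → ¬ A → ⟦ a? ⟧ ≡ 0ℤ
⟦⟧-no (yes a) ¬a = contradiction a ¬a
⟦⟧-no (no _)  ¬a = refl

⟦⟧-iff : {A B : Set} (a? : Dec A) (b? : Dec B) → (A → B) → (B → A) → ⟦ a? ⟧ ≡ ⟦ b? ⟧
⟦⟧-iff (yes a) b? f g = sym (⟦⟧-yes b? (f a))
⟦⟧-iff (no ¬a) b? f g = sym (⟦⟧-no b? (¬a ∘ g))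

⟦⟧-*-cong : {A : Set} (a? : Dec A) {x y : ℤ} → (A → x ≡ y) → ⟦ a? ⟧ * x ≡ ⟦ a? ⟧ * y
⟦⟧-*-cong (yes a) eq = cong (1ℤ *_) (eq a)
⟦⟧-*-cong (no _)  eq = refl

⟦⟧-*-zero : {A : Set} (a? : Dec A) {x : ℤ} → (A → x ≡ 0ℤ) → ⟦ a? ⟧ * x ≡ 0ℤ
⟦⟧-*-zero (yes a) eq = trans (ℤ.*-identityˡ _) (eq a)
⟦⟧-*-zero (no _)  eq = refl

sum-swap : ∀ {m n} (a : Fin m → ℤ) (f : Fin m → Fin n → ℤ) →
           sum (λ i → a i * sum (f i)) ≡ sum λ j → sum λ i → a i * f i j
sum-swap a f = trans (sum-cong-≗ λ i → *-distribˡ-sum (a i) (f i)) (∑-comm λ i j → a i * f i j)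

sum-*ʳ : ∀ {m} (f : Fin m → ℤ) c → sum (λ i → f i * c) ≡ sum f * c
sum-*ʳ f c = trans (sum-cong-≗ λ i → ℤ.*-comm (f i) c)
                   (trans (sym (*-distribˡ-sum c f)) (ℤ.*-comm c (sum f)))

sum-neg : ∀ {m} (f : Fin m → ℤ) → sum (λ i → - f i) ≡ - sum f
sum-neg f = trans (sum-cong-≗ λ i → sym (ℤ.-1*i≡-i (f i)))
                  (trans (sym (*-distribˡ-sum -1ℤ f)) (ℤ.-1*i≡-i (sum f)))

sum-sub : ∀ {m} (f g : Fin m → ℤ) → sum (λ i → f i - g i) ≡ sum f - sum g
sum-sub f g = trans (∑-distrib-+ f (λ i → - g i)) (cong (_+_ (sum f)) (sum-neg g))

-- ∑< n f is f 0 + … + f (n - 1).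

∑< : ℕ → (ℕ → ℤ) → ℤ
∑< n f = sum λ (i : Fin n) → f (toℕ i)

∑<-cong : ∀ n {f g} → (∀ i → i ℕ.< n → f i ≡ g i) → ∑< n f ≡ ∑< n g
∑<-cong n f≡g = sum-cong-≗ λ i → f≡g (toℕ i) (Fin.toℕ<n i)

∑<-zero : ∀ n {f} → (∀ i → i ℕ.< n → f i ≡ 0ℤ) → ∑< n f ≡ 0ℤ
∑<-zero n f≡0 = sum-zero λ i → f≡0 (toℕ i) (Fin.toℕ<n i)

∑<-last : ∀ n f → ∑< (suc n) f ≡ ∑< n f + f n
∑<-last zero    f = ℤ.+-comm (f 0) 0ℤ
∑<-last (suc n) f = trans (cong (_+_ (f 0)) (∑<-last n (f ∘ suc))) (sym (ℤ.+-assoc (f 0) _ _))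

∑<-reverse : ∀ n f → ∑< (suc n) (λ i → f (n ∸ i)) ≡ ∑< (suc n) f
∑<-reverse zero    f = refl
∑<-reverse (suc n) f = begin
  f (suc n) + ∑< (suc n) (λ i → f (n ∸ i)) ≡⟨ cong (_+_ (f (suc n))) (∑<-reverse n f) ⟩
  f (suc n) + ∑< (suc n) f                 ≡⟨ ℤ.+-comm (f (suc n)) _ ⟩
  ∑< (suc n) f + f (suc n)                 ≡⟨ ∑<-last (suc n) f ⟨
  ∑< (suc (suc n)) f                       ∎

∑<-single : ∀ n {f} j → j ℕ.< n → (∀ i → i ≢ j → f i ≡ 0ℤ) → ∑< n f ≡ f j
∑<-single n {f} j j<n off = trans
  (sum-single {F = f ∘ toℕ} (fromℕ< j<n) λ i i≢j → off (toℕ i) λ ti≡j →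
    i≢j (Fin.toℕ-injective (trans ti≡j (sym (Fin.toℕ-fromℕ< j<n)))))
  (cong f (Fin.toℕ-fromℕ< j<n))

-- Multiplication by powers of x and x - 1

-- Multiplication by x is coeff-below, and D is multiplication by x - 1.

D : Poly → Poly
D p k = coeff-below p k - p k

-- The new factor acts on the argument first, so that the inductions of `B-D^` and `B-shift` pass
-- from `p` to `D p` by computation.
D^ : ℕ → Poly → Poly
D^ zero    p = p
D^ (suc m) p = D^ m (D p)

shift : ℕ → Poly → Poly
shift zero    p k       = p k
shift (suc m) p zero    = 0ℤ
shift (suc m) p (suc k) = shift m p k

-- The polynomial (x - 1)^i.
E : ℕ → Poly
E i = D^ i 1ₚ

below-cong : ∀ {p q} → p ≗ q → coeff-below p ≗ coeff-below q
below-cong p≗q zero    = refl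
below-cong p≗q (suc k) = p≗q k

D-cong : ∀ {p q} → p ≗ q → D p ≗ D q
D-cong p≗q k = cong₂ _-_ (below-cong p≗q k) (p≗q k)

D^-cong : ∀ m {p q} → p ≗ q → D^ m p ≗ D^ m q
D^-cong zero    p≗q = p≗q
D^-cong (suc m) p≗q = D^-cong m (D-cong p≗q)

D^-+ : ∀ m n p → D^ n (D^ m p) ≡ D^ (m ℕ.+ n) p
D^-+ zero    n p = refl
D^-+ (suc m) n p = D^-+ m n (D p)

D-D^ : ∀ m p → D (D^ m p) ≡ D^ (suc m) p
D-D^ m p = trans (D^-+ m 1 p) (cong (λ n → D^ n p) (ℕ.+-comm m 1))

below-sum : ∀ {n} (c : Fin n → ℤ) (p : Fin n → Poly) →
            coeff-below (λ k → sum λ i → c i * p i k) ≗ λ k → sum λ i → c i * coeff-below (p i) k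
below-sum c p zero    = sym (sum-zero λ i → ℤ.*-zeroʳ (c i))
below-sum c p (suc k) = refl

D-sum : ∀ {n} (c : Fin n → ℤ) (p : Fin n → Poly) →
        D (λ k → sum λ i → c i * p i k) ≗ λ k → sum λ i → c i * D (p i) k
D-sum c p k = begin
  coeff-below (λ k → sum λ i → c i * p i k) k - sum (λ i → c i * p i k)
    ≡⟨ cong (_- sum (λ i → c i * p i k)) (below-sum c p k) ⟩
  sum (λ i → c i * coeff-below (p i) k) - sum (λ i → c i * p i k)
    ≡⟨ sum-sub (λ i → c i * coeff-below (p i) k) (λ i → c i * p i k) ⟨
  sum (λ i → c i * coeff-below (p i) k - c i * p i k)
    ≡⟨ sum-cong-≗ (λ i → *-distribˡ-- (c i) (coeff-below (p i) k) (p i k)) ⟩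
  sum (λ i → c i * D (p i) k) ∎
  where
  *-distribˡ-- : ∀ a b c → a * b - a * c ≡ a * (b - c)
  *-distribˡ-- = solve-∀

D^-sum : ∀ m {n} (c : Fin n → ℤ) (p : Fin n → Poly) →
         D^ m (λ k → sum λ i → c i * p i k) ≗ λ k → sum λ i → c i * D^ m (p i) k
D^-sum zero    c p k = refl
D^-sum (suc m) c p k = trans (D^-cong m (D-sum c p) k) (D^-sum m c (D ∘ p) k)

shift-sum : ∀ m {n} (c : Fin n → ℤ) (p : Fin n → Poly) →
            shift m (λ k → sum λ i → c i * p i k) ≗ λ k → sum λ i → c i * shift m (p i) k
shift-sum zero    c p k       = refl
shift-sum (suc m) c p zero    = sym (sum-zero λ i → ℤ.*-zeroʳ (c i))
shift-sum (suc m) c p (suc k) = shift-sum m c p k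

shift-below : ∀ m p → shift m (coeff-below p) ≗ shift (suc m) p
shift-below zero    p zero    = refl
shift-below zero    p (suc k) = refl
shift-below (suc m) p zero    = refl
shift-below (suc m) p (suc k) = shift-below m p k

shift-+ : ∀ m p q k → shift m p k + shift m q k ≡ shift m (p ⊕ q) k
shift-+ zero    p q k       = refl
shift-+ (suc m) p q zero    = refl
shift-+ (suc m) p q (suc k) = shift-+ m p q k

shift-cong : ∀ m {p q} → p ≗ q → shift m p ≗ shift m q
shift-cong zero    p≗q k       = p≗q k
shift-cong (suc m) p≗q zero    = refl
shift-cong (suc m) p≗q (suc k) = shift-cong m p≗q k

shift-* : ∀ m c p k → shift m (c · p) k ≡ c * shift m p k
shift-* zero    c p k       = refl
shift-* (suc m) c p zero    = sym (ℤ.*-zeroʳ c)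
shift-* (suc m) c p (suc k) = shift-* m c p k

D^-* : ∀ m c p k → D^ m (c · p) k ≡ c * D^ m p k
D^-* m c p k = begin
  D^ m (c · p) k ≡⟨ D^-cong m (λ k → sym (ℤ.+-identityʳ (c * p k))) k ⟩
  D^ m (λ k → sum λ (i : Fin 1) → c * p k) k ≡⟨ D^-sum m {1} (λ _ → c) (λ _ → p) k ⟩
  c * D^ m p k + 0ℤ ≡⟨ ℤ.+-identityʳ _ ⟩
  c * D^ m p k ∎

D^-⊕ : ∀ m p q k → D^ m (p ⊕ q) k ≡ D^ m p k + D^ m q k
D^-⊕ zero    p q k = refl
D^-⊕ (suc m) p q k = trans (D^-cong m D-⊕ k) (D^-⊕ m (D p) (D q) k)
  where
  interchange : ∀ a b c d → a + b - (c + d) ≡ a - c + (b - d)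
  interchange = solve-∀
  D-⊕ : D (p ⊕ q) ≗ D p ⊕ D q
  D-⊕ zero    = interchange 0ℤ 0ℤ (p 0) (q 0)
  D-⊕ (suc k) = interchange (p k) (q k) (p (suc k)) (q (suc k))

-- Each factor x raises the vanishing range by a full degree, and half a degree is enough here. The
-- bound has the form 2k < d because Stanley's truncation cuts at half the rank.
shift-vanish : ∀ m p {d} → (∀ k → 2 ℕ.* k ℕ.< d → p k ≡ 0ℤ) →
               ∀ k → 2 ℕ.* k ℕ.< m ℕ.+ d → shift m p k ≡ 0ℤ
shift-vanish zero    p p≡0 k       k< = p≡0 k k<
shift-vanish (suc m) p p≡0 zero    k< = refl
shift-vanish (suc m) p {d} p≡0 (suc k) k< = shift-vanish m p p≡0 k
  (ℕ.≤-trans (ℕ.n≤1+n _) (ℕ.≤-pred (subst (ℕ._< suc m ℕ.+ d) (cong suc (ℕ.+-suc k (k ℕ.+ 0))) k<)))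

-- Each `D` raises a degree bound by one. Since `D^` acts on its argument, the induction ranges over
-- arbitrary starting polynomials of degree at most d.
E-high : ∀ i k → i ℕ.< k → E i k ≡ 0ℤ
E-high i k i<k = go i 1ₚ {0} (λ { (suc k) _ → refl }) k (subst (ℕ._< k) (sym (ℕ.+-identityʳ i)) i<k)
  where
  go : ∀ i p {d} → (∀ k → d ℕ.< k → p k ≡ 0ℤ) → ∀ k → i ℕ.+ d ℕ.< k → D^ i p k ≡ 0ℤ
  go zero    p     p≡0 k k> = p≡0 k k>
  go (suc i) p {d} p≡0 k k> = go i (D p) {suc d} Dp≡0 k (subst (ℕ._< k) (sym (ℕ.+-suc i d)) k>)
    where
    Dp≡0 : ∀ k → suc d ℕ.< k → D p k ≡ 0ℤ
    Dp≡0 (suc k) 1+d<1+k =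
      cong₂ _-_ (p≡0 k (ℕ.≤-pred 1+d<1+k)) (p≡0 (suc k) (ℕ.<-trans (ℕ.n<1+n d) 1+d<1+k))

E-suc : ∀ i k → E (suc i) k ≡ D (E i) k
E-suc i k = cong (_$ k) (sym (D-D^ i 1ₚ))

-1^-suc : ∀ i → -1ℤ ^ suc i ≡ - (-1ℤ ^ i)
-1^-suc i = ℤ.-1*i≡-i (-1ℤ ^ i)

-- Coefficientwise form of x^i (1/x - 1)^i = (-1)^i (x - 1)^i.
E-reverse : ∀ i {a b} → a ℕ.+ b ≡ i → E i a ≡ -1ℤ ^ i * E i b
E-reverse zero    {zero}  {zero} refl = refl
E-reverse (suc i) {a}     {b}    a+b≡ = begin
  E (suc i) a ≡⟨ E-suc i a ⟩
  D (E i) a   ≡⟨ step a b a+b≡ ⟩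
  - (-1ℤ ^ i * D (E i) b) ≡⟨ ℤ.neg-distribˡ-* (-1ℤ ^ i) _ ⟩
  - (-1ℤ ^ i) * D (E i) b ≡⟨ cong₂ _*_ (-1^-suc i) (E-suc i b) ⟨
  -1ℤ ^ suc i * E (suc i) b ∎
  where
  s = -1ℤ ^ i
  sgn : ∀ s x y → s * x - s * y ≡ - (s * (y - x))
  sgn = solve-∀
  step : ∀ a b → a ℕ.+ b ≡ suc i → D (E i) a ≡ - (s * D (E i) b)
  step zero    (suc b) refl = begin
    0ℤ - E i 0            ≡⟨ cong (_-_ 0ℤ) (E-reverse i {0} {i} refl) ⟩
    0ℤ - s * E i i        ≡⟨ cong (λ z → z - s * E i i) (sym (ℤ.*-zeroʳ s)) ⟩
    s * 0ℤ - s * E i i      ≡⟨ cong (λ z → s * z - s * E i i) (E-high i (suc i) ℕ.≤-refl) ⟨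
    s * E i (suc i) - s * E i i ≡⟨ sgn s (E i (suc i)) (E i i) ⟩
    - (s * (E i i - E i (suc i))) ∎
  step (suc a) zero    eq = begin
    E i a - E i (suc a)   ≡⟨ cong₂ _-_ (E-reverse i {a} {0} (ℕ.suc-injective eq)) (E-high i (suc a) i<1+a) ⟩
    s * E i 0 - 0ℤ        ≡⟨ cong (λ z → s * E i 0 - z) (ℤ.*-zeroʳ s) ⟨
    s * E i 0 - s * 0ℤ    ≡⟨ sgn s (E i 0) 0ℤ ⟩
    - (s * (0ℤ - E i 0))  ∎
    where
    i<1+a : i ℕ.< suc a
    i<1+a = ℕ.≤-reflexive (trans (sym eq) (ℕ.+-identityʳ (suc a)))
  step (suc a) (suc b) eq = begin
    E i a - E i (suc a) ≡⟨ cong₂ _-_ (E-reverse i {a} {suc b} (ℕ.suc-injective eq))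
                                     (E-reverse i {suc a} {b} (trans (sym (ℕ.+-suc a b)) (ℕ.suc-injective eq))) ⟩
    s * E i (suc b) - s * E i b ≡⟨ sgn s (E i (suc b)) (E i b) ⟩
    - (s * (E i b - E i (suc b))) ∎

-- Reversing in degree m + i instead of i produces an extra factor x^m.
E-reverse-shift : ∀ m i {a b} → a ℕ.+ b ≡ m ℕ.+ i → E i a ≡ -1ℤ ^ i * shift m (E i) b
E-reverse-shift zero    i             eq = E-reverse i eq
E-reverse-shift (suc m) i {a} {zero}  eq = trans
  (E-high i a (ℕ.≤-trans (ℕ.s≤s (ℕ.m≤n+m i m)) (ℕ.≤-reflexive (trans (sym eq) (ℕ.+-identityʳ a)))))
  (sym (ℤ.*-zeroʳ (-1ℤ ^ i)))
E-reverse-shift (suc m) i {a} {suc b} eq =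
  E-reverse-shift m i {a} {b} (ℕ.suc-injective (trans (sym (ℕ.+-suc a b)) eq))

-- Factors x - 1 are moved one at a time from the right argument of the product to the left, using p
-- (x q) = (x p) q. This turns the summands of Stanley's f into iterates of `D`.
⊛-D^ : ∀ d p → p ⊛ [X-1]^ d ≗ D^ d p
⊛-D^ zero    p k = unit p k
  where
  unit : ∀ p k → (p ⊛ 1ₚ) k ≡ p k
  unit p zero    = trans (ℤ.+-identityʳ _) (ℤ.*-identityʳ (p 0))
  unit p (suc k) = trans (cong (_+ ((p ∘ suc) ⊛ 1ₚ) k) (ℤ.*-zeroʳ (p 0)))
                         (trans (ℤ.+-identityˡ _) (unit (p ∘ suc) k))
⊛-D^ (suc d) p k = begin
  (p ⊛ ((X^ 1 ⊖ 1ₚ) ⊛ [X-1]^ d)) k ≡⟨ sum-cong-≗ (λ (i : Fin (suc k)) → cong (p (toℕ i) *_) (X-1⊛ ([X-1]^ d) (k ∸ toℕ i))) ⟩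
  (p ⊛ D ([X-1]^ d)) k ≡⟨ sum-cong-≗ (λ (i : Fin (suc k)) → distrib (p (toℕ i)) (coeff-below ([X-1]^ d) (k ∸ toℕ i)) (([X-1]^ d) (k ∸ toℕ i))) ⟩
  sum (λ (i : Fin (suc k)) → p (toℕ i) * coeff-below ([X-1]^ d) (k ∸ toℕ i) - p (toℕ i) * ([X-1]^ d) (k ∸ toℕ i))
    ≡⟨ sum-sub (λ (i : Fin (suc k)) → p (toℕ i) * coeff-below ([X-1]^ d) (k ∸ toℕ i)) (λ i → p (toℕ i) * ([X-1]^ d) (k ∸ toℕ i)) ⟩
  (p ⊛ coeff-below ([X-1]^ d)) k - (p ⊛ [X-1]^ d) k ≡⟨ cong₂ _-_ (below-⊛ p ([X-1]^ d) k) refl ⟩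
  (coeff-below p ⊛ [X-1]^ d) k - (p ⊛ [X-1]^ d) k
    ≡⟨ sum-sub (λ (i : Fin (suc k)) → coeff-below p (toℕ i) * ([X-1]^ d) (k ∸ toℕ i)) (λ i → p (toℕ i) * ([X-1]^ d) (k ∸ toℕ i)) ⟨
  sum (λ (i : Fin (suc k)) → coeff-below p (toℕ i) * ([X-1]^ d) (k ∸ toℕ i) - p (toℕ i) * ([X-1]^ d) (k ∸ toℕ i))
    ≡⟨ sum-cong-≗ (λ (i : Fin (suc k)) → distribʳ (coeff-below p (toℕ i)) (p (toℕ i)) (([X-1]^ d) (k ∸ toℕ i))) ⟩
  (D p ⊛ [X-1]^ d) k ≡⟨ ⊛-D^ d (D p) k ⟩
  D^ d (D p) k ∎
  where
  distrib : ∀ a b c → a * (b - c) ≡ a * b - a * c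
  distrib = solve-∀
  distribʳ : ∀ a b c → a * c - b * c ≡ (a - b) * c
  distribʳ = solve-∀
  X-1⊛ : ∀ q → (X^ 1 ⊖ 1ₚ) ⊛ q ≗ D q
  X-1⊛ q zero    = eq (q 0)
    where
    eq : ∀ x → -1ℤ * x + 0ℤ ≡ 0ℤ - x
    eq = solve-∀
  X-1⊛ q (suc k) = trans (cong (λ z → -1ℤ * q (suc k) + (1ℤ * q k + z))
                               (sum-zero λ (i : Fin k) → refl)) (eq (q (suc k)) (q k))
    where
    eq : ∀ x y → -1ℤ * x + (1ℤ * y + 0ℤ) ≡ y - x
    eq = solve-∀
  below-⊛-suc : ∀ p q k → (p ⊛ coeff-below q) (suc k) ≡ (p ⊛ q) k
  below-⊛-suc p q zero    = cong (λ z → p 0 * q 0 + z) (trans (ℤ.+-identityʳ _) (ℤ.*-zeroʳ (p 1)))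
  below-⊛-suc p q (suc k) = cong (λ z → p 0 * q (suc k) + z) (below-⊛-suc (p ∘ suc) q k)
  below-⊛ : ∀ p q → p ⊛ coeff-below q ≗ coeff-below p ⊛ q
  below-⊛ p q zero    = trans (ℤ.+-identityʳ _) (ℤ.*-zeroʳ (p 0))
  below-⊛ p q (suc k) = trans (below-⊛-suc p q k) (sym (ℤ.+-identityˡ _))

-- Sums over Boolean algebras

-- B m F is the sum of F |S| over the subsets S of a set of m elements.

B : ℕ → (ℕ → ℤ) → ℤ
B zero    F = F 0
B (suc m) F = B m F + B m (F ∘ suc)

B-cong : ∀ m {F G} → (∀ j → j ℕ.≤ m → F j ≡ G j) → B m F ≡ B m G
B-cong zero    F≡G = F≡G 0 ℕ.z≤n
B-cong (suc m) F≡G = cong₂ _+_ (B-cong m λ j j≤m → F≡G j (ℕ.m≤n⇒m≤1+n j≤m))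
                               (B-cong m λ j j≤m → F≡G (suc j) (ℕ.s≤s j≤m))

B-zero : ∀ m → B m (λ _ → 0ℤ) ≡ 0ℤ
B-zero zero    = refl
B-zero (suc m) = cong₂ _+_ (B-zero m) (B-zero m)

B-+ : ∀ m F G → B m (λ j → F j + G j) ≡ B m F + B m G
B-+ zero    F G = refl
B-+ (suc m) F G = trans (cong₂ _+_ (B-+ m F G) (B-+ m (F ∘ suc) (G ∘ suc)))
                        (interchange (B m F) (B m G) (B m (F ∘ suc)) (B m (G ∘ suc)))
  where
  interchange : ∀ a b c d → (a + b) + (c + d) ≡ (a + c) + (b + d)
  interchange = solve-∀

B-* : ∀ m c F → B m (λ j → c * F j) ≡ c * B m F
B-* zero    c F = refl
B-* (suc m) c F = trans (cong₂ _+_ (B-* m c F) (B-* m c (F ∘ suc))) (sym (ℤ.*-distribˡ-+ c _ _))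

-- Complementation of subsets; in the induction it exchanges the two halves of `B`.
B-reverse : ∀ m F → B m (λ j → F (m ∸ j)) ≡ B m F
B-reverse zero    F = refl
B-reverse (suc m) F = begin
  B m (λ j → F (suc m ∸ j)) + B m (λ j → F (m ∸ j))
    ≡⟨ cong₂ _+_ (B-cong m λ j j≤m → cong F (ℕ.+-∸-assoc 1 j≤m)) (B-reverse m F) ⟩
  B m (λ j → F (suc (m ∸ j))) + B m F ≡⟨ cong (_+ B m F) (B-reverse m (F ∘ suc)) ⟩
  B m (F ∘ suc) + B m F ≡⟨ ℤ.+-comm (B m (F ∘ suc)) (B m F) ⟩
  B m F + B m (F ∘ suc) ∎

-- xᵐ = (1 + (x - 1))ᵐ

B-D^ : ∀ m p k → B m (λ j → D^ j p k) ≡ shift m p k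
B-D^ zero    p k = refl
B-D^ (suc m) p k = begin
  B m (λ j → D^ j p k) + B m (λ j → D^ j (D p) k) ≡⟨ cong₂ _+_ (B-D^ m p k) (B-D^ m (D p) k) ⟩
  shift m p k + shift m (D p) k ≡⟨ shift-+ m p (D p) k ⟩
  shift m (p ⊕ D p) k ≡⟨ shift-cong m (λ k → cancel (p k) (coeff-below p k)) k ⟩
  shift m (coeff-below p) k ≡⟨ shift-below m p k ⟩
  shift (suc m) p k ∎
  where
  cancel : ∀ a b → a + (b - a) ≡ b
  cancel = solve-∀

-- (x - 1)ᵐ = ∑ⱼ C(m,j) (-1)ʲ xᵐ⁻ʲ

B-shift : ∀ m p k → B m (λ j → -1ℤ ^ j * shift (m ∸ j) p k) ≡ D^ m p k
B-shift zero    p k = ℤ.*-identityˡ (p k)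
B-shift (suc m) p k = begin
  B m (λ j → -1ℤ ^ j * shift (suc m ∸ j) p k) + B m (λ j → -1ℤ ^ suc j * shift (m ∸ j) p k)
    ≡⟨ B-+ m (λ j → -1ℤ ^ j * shift (suc m ∸ j) p k) (λ j → -1ℤ ^ suc j * shift (m ∸ j) p k) ⟨
  B m (λ j → -1ℤ ^ j * shift (suc m ∸ j) p k + -1ℤ ^ suc j * shift (m ∸ j) p k)
    ≡⟨ B-cong m step ⟩
  B m (λ j → -1ℤ ^ j * shift (m ∸ j) (D p) k) ≡⟨ B-shift m (D p) k ⟩
  D^ m (D p) k ∎
  where
  factor : ∀ s a b → s * a + (-1ℤ * s) * b ≡ s * (a + -1ℤ * b)
  factor = solve-∀
  step : ∀ j → j ℕ.≤ m → -1ℤ ^ j * shift (suc m ∸ j) p k + -1ℤ ^ suc j * shift (m ∸ j) p k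
         ≡ -1ℤ ^ j * shift (m ∸ j) (D p) k
  step j j≤m = begin
    -1ℤ ^ j * shift (suc m ∸ j) p k + -1ℤ ^ suc j * shift (m ∸ j) p k
      ≡⟨ factor (-1ℤ ^ j) _ _ ⟩
    -1ℤ ^ j * (shift (suc m ∸ j) p k + -1ℤ * shift (m ∸ j) p k)
      ≡⟨ cong (λ z → -1ℤ ^ j * z) (cong₂ _+_ (trans (cong (λ i → shift i p k) (ℕ.+-∸-assoc 1 j≤m)) (sym (shift-below (m ∸ j) p k))) (sym (shift-* (m ∸ j) -1ℤ p k))) ⟩
    -1ℤ ^ j * (shift (m ∸ j) (coeff-below p) k + shift (m ∸ j) (-1ℤ · p) k)
      ≡⟨ cong (-1ℤ ^ j *_) (trans (shift-+ (m ∸ j) (coeff-below p) (-1ℤ · p) k) (shift-cong (m ∸ j) (λ k → cong (_+_ (coeff-below p k)) (ℤ.-1*i≡-i (p k))) k)) ⟩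
    -1ℤ ^ j * shift (m ∸ j) (D p) k ∎

∑Subset : ∀ m → (Subset m → ℤ) → ℤ
∑Subset zero    F = F []
∑Subset (suc m) F = ∑Subset m (F ∘ (outside ∷_)) + ∑Subset m (F ∘ (inside ∷_))

∑Subset-cong : ∀ m {F G} → F ≗ G → ∑Subset m F ≡ ∑Subset m G
∑Subset-cong zero    F≗G = F≗G []
∑Subset-cong (suc m) F≗G = cong₂ _+_ (∑Subset-cong m (F≗G ∘ (outside ∷_))) (∑Subset-cong m (F≗G ∘ (inside ∷_)))

∑Subset-zero : ∀ m {F} → (∀ S → F S ≡ 0ℤ) → ∑Subset m F ≡ 0ℤ
∑Subset-zero zero    F≡0 = F≡0 []
∑Subset-zero (suc m) F≡0 =
  cong₂ _+_ (∑Subset-zero m (F≡0 ∘ (outside ∷_))) (∑Subset-zero m (F≡0 ∘ (inside ∷_)))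

∑Subset-single : ∀ m {F} T → (∀ S → S ≢ T → F S ≡ 0ℤ) → ∑Subset m F ≡ F T
∑Subset-single zero    []            off = refl
∑Subset-single (suc m) (outside ∷ T) off =
  trans (cong₂ _+_ (∑Subset-single m T λ S S≢T → off _ λ { refl → S≢T refl }) (∑Subset-zero m λ S → off _ λ ()))
        (ℤ.+-identityʳ _)
∑Subset-single (suc m) (inside ∷ T)  off =
  trans (cong₂ _+_ (∑Subset-zero m λ S → off _ λ ()) (∑Subset-single m T λ S S≢T → off _ λ { refl → S≢T refl }))
        (ℤ.+-identityˡ _)

sum-∑Subset : ∀ {n} m (f : Fin n → Subset m → ℤ) →
              sum (λ i → ∑Subset m (f i)) ≡ ∑Subset m λ S → sum λ i → f i S
sum-∑Subset zero    f = refl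
sum-∑Subset (suc m) f = trans (∑-distrib-+ (λ i → ∑Subset m (f i ∘ (outside ∷_))) (λ i → ∑Subset m (f i ∘ (inside ∷_))))
  (cong₂ _+_ (sum-∑Subset m λ i → f i ∘ (outside ∷_)) (sum-∑Subset m λ i → f i ∘ (inside ∷_)))

-- An element of `T` may lie in `S` or not, which gives both halves of `B`; an element outside `T`
-- leaves only the half of the subsets avoiding it.
∑Subset-⊆ : ∀ m T (F : ℕ → ℤ) → ∑Subset m (λ S → ⟦ S ⊆? T ⟧ * F ∣ S ∣) ≡ B ∣ T ∣ F
∑Subset-⊆ zero    []            F = ℤ.*-identityˡ (F 0)
∑Subset-⊆ (suc m) (outside ∷ T) F = trans
  (cong₂ _+_
    (trans (∑Subset-cong m λ S → cong (_* F ∣ S ∣) (⟦⟧-iff (outside ∷ S ⊆? outside ∷ T) (S ⊆? T) drop-∷-⊆ out⊆))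
           (∑Subset-⊆ m T F))
    (∑Subset-zero m λ S → refl))
  (ℤ.+-identityʳ _)
∑Subset-⊆ (suc m) (inside ∷ T)  F = cong₂ _+_
  (trans (∑Subset-cong m λ S → cong (_* F ∣ S ∣) (⟦⟧-iff (outside ∷ S ⊆? inside ∷ T) (S ⊆? T) drop-∷-⊆ out⊆))
         (∑Subset-⊆ m T F))
  (trans (∑Subset-cong m λ S → cong (_* F (suc ∣ S ∣)) (⟦⟧-iff (inside ∷ S ⊆? inside ∷ T) (S ⊆? T) drop-∷-⊆ in⊆in))
         (∑Subset-⊆ m T (F ∘ suc)))

-- Finite sums over a graded poset

when-const : {A : Set} (a? : Dec A) (z : ℤ) → when a? (λ _ → z) ≡ ⟦ a? ⟧ * z
when-const (yes _) z = sym (ℤ.*-identityˡ z)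
when-const (no _)  z = refl

module Sums (Q : GradedPoset) where
  open GradedPoset Q

  ∑ₓ : (Carrier → ℤ) → ℤ
  ∑ₓ F = sum (F ∘ element)

  ∑ₓ-cong : ∀ {F G} → F ≗ G → ∑ₓ F ≡ ∑ₓ G
  ∑ₓ-cong F≗G = sum-cong-≗ (F≗G ∘ element)

  ∑ₓ-single : ∀ {F} p → (∀ q → q ≢ p → F q ≡ 0ℤ) → ∑ₓ F ≡ F p
  ∑ₓ-single {F} p off = trans
    (sum-single {F = F ∘ element} (index p) λ j j≢ → off (element j) λ ej≡p →
      j≢ (trans (sym (index-element j)) (cong index ej≡p)))
    (cong F (element-index p))
    where
    index-element : ∀ j → index (element j) ≡ j
    index-element = Inverse.strictlyInverseʳ finite

  ∑ₓ-* : ∀ c (F : Carrier → ℤ) → ∑ₓ (λ q → c * F q) ≡ c * ∑ₓ F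
  ∑ₓ-* c F = sym (*-distribˡ-sum c (F ∘ element))

  ∑ₓ-+ : ∀ F G → ∑ₓ (λ q → F q + G q) ≡ ∑ₓ F + ∑ₓ G
  ∑ₓ-+ F G = ∑-distrib-+ (F ∘ element) (G ∘ element)

  ∑ₓ-swap : ∀ a (F : Carrier → Carrier → ℤ) → ∑ₓ (λ x → a x * ∑ₓ (F x)) ≡ ∑ₓ λ y → ∑ₓ λ x → a x * F x y
  ∑ₓ-swap a F = sum-swap (a ∘ element) λ i → F (element i) ∘ element

  -- Double counting of the pairs with ψ S = x, weighted by F x: each x in the image has exactly one
  -- preimage, and every other x contributes zero.
  ∑ₓ-Subset : ∀ {m} (ψ : Subset m → Carrier) → (∀ {S T} → ψ S ≡ ψ T → S ≡ T) →
              ∀ F → (∀ x → (∃[ S ] ψ S ≡ x) ⊎ F x ≡ 0ℤ) → ∑ₓ F ≡ ∑Subset m (F ∘ ψ)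
  ∑ₓ-Subset {m} ψ inj F image = begin
    ∑ₓ F ≡⟨ ∑ₓ-cong spread ⟩
    ∑ₓ (λ x → ∑Subset m λ S → ⟦ ψ S ≟ x ⟧ * F x)
      ≡⟨ sum-∑Subset m (λ i S → ⟦ ψ S ≟ element i ⟧ * F (element i)) ⟩
    ∑Subset m (λ S → ∑ₓ λ x → ⟦ ψ S ≟ x ⟧ * F x)
      ≡⟨ ∑Subset-cong m (λ S → trans
           (∑ₓ-single (ψ S) λ q q≢ψS → cong (_* F q) (⟦⟧-no (ψ S ≟ q) (q≢ψS ∘ sym)))
           (trans (cong (_* F (ψ S)) (⟦⟧-yes (ψ S ≟ ψ S) refl)) (ℤ.*-identityˡ _))) ⟩
    ∑Subset m (F ∘ ψ) ∎
    where
    spread : ∀ x → F x ≡ ∑Subset m λ S → ⟦ ψ S ≟ x ⟧ * F x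
    spread x with image x
    ... | inj₁ (T , refl) = sym (trans
          (∑Subset-single m T λ S S≢T → cong (_* F (ψ T)) (⟦⟧-no (ψ S ≟ ψ T) (S≢T ∘ inj)))
          (trans (cong (_* F (ψ T)) (⟦⟧-yes (ψ T ≟ ψ T) refl)) (ℤ.*-identityˡ _)))
    ... | inj₂ Fx≡0 = trans Fx≡0 (sym (∑Subset-zero m λ S →
          trans (cong (⟦ ψ S ≟ x ⟧ *_) Fx≡0) (ℤ.*-zeroʳ ⟦ ψ S ≟ x ⟧)))

  -- The zeta function of the incidence algebra.
  ζ : Carrier → Carrier → ℤ
  ζ x y = ⟦ x ≤? y ⟧

  ζ-refl : ∀ p → ζ p p ≡ 1ℤ
  ζ-refl p = ⟦⟧-yes (p ≤? p) ≤-refl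

  ζ-split : ∀ q p → ζ q p ≡ ⟦ q <? p ⟧ + ⟦ q ≟ p ⟧
  ζ-split q p = go (q ≟ p)
    where
    go : Dec (q ≡ p) → ζ q p ≡ ⟦ q <? p ⟧ + ⟦ q ≟ p ⟧
    go (yes refl) = trans (ζ-refl p)
      (sym (cong₂ _+_ (⟦⟧-no (p <? p) λ p<p → proj₂ p<p refl) (⟦⟧-yes (p ≟ p) refl)))
    go (no q≢p)   = trans (⟦⟧-iff (q ≤? p) (q <? p) (_, q≢p) proj₁)
      (trans (sym (ℤ.+-identityʳ _)) (cong (_+_ ⟦ q <? p ⟧) (sym (⟦⟧-no (q ≟ p) q≢p))))

  ∑ₓ-ζ-split : ∀ p (F : Carrier → ℤ) → ∑ₓ (λ q → ζ q p * F q) ≡ ∑ₓ (λ q → ⟦ q <? p ⟧ * F q) + F p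
  ∑ₓ-ζ-split p F = begin
    ∑ₓ (λ q → ζ q p * F q)
      ≡⟨ ∑ₓ-cong (λ q → trans (cong (_* F q) (ζ-split q p)) (ℤ.*-distribʳ-+ (F q) ⟦ q <? p ⟧ ⟦ q ≟ p ⟧)) ⟩
    ∑ₓ (λ q → ⟦ q <? p ⟧ * F q + ⟦ q ≟ p ⟧ * F q)
      ≡⟨ ∑ₓ-+ (λ q → ⟦ q <? p ⟧ * F q) (λ q → ⟦ q ≟ p ⟧ * F q) ⟩
    ∑ₓ (λ q → ⟦ q <? p ⟧ * F q) + ∑ₓ (λ q → ⟦ q ≟ p ⟧ * F q)
      ≡⟨ cong (_+_ (∑ₓ λ q → ⟦ q <? p ⟧ * F q)) (trans
           (∑ₓ-single p λ q q≢p → cong (_* F q) (⟦⟧-no (q ≟ p) q≢p))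
           (trans (cong (_* F p) (⟦⟧-yes (p ≟ p) refl)) (ℤ.*-identityˡ (F p)))) ⟩
    ∑ₓ (λ q → ⟦ q <? p ⟧ * F q) + F p ∎

  0̂<  : ∀ {p} → p ≢ 0̂ → 0̂ < p
  0̂< p≢0̂ = 0̂-minimum _ , p≢0̂ ∘ sym

  ρ-suc : ∀ {p} → p ≢ 0̂ → ∃[ d ] ρ p ≡ suc d
  ρ-suc {p} p≢0̂ with ρ p | ρ-mono-< (0̂< p≢0̂)
  ... | suc d | _ = d , refl

  ρ-mono-≤ : ∀ {x y} → x ≤ y → ρ x ℕ.≤ ρ y
  ρ-mono-≤ {x} {y} x≤y with x ≟ y
  ... | yes refl = ℕ.≤-refl
  ... | no x≢y   = ℕ.<⇒≤ (ρ-mono-< (x≤y , x≢y))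

  -- Climb from 0̂ through elements below p for as long as another one fits in between; the climb
  -- ends by finiteness, at an element covered by p.
  lower-cover : ∀ {p} → p ≢ 0̂ → ∃[ q ] q ⋖ p
  lower-cover {p} p≢0̂ = go 0̂ (>-wellFounded 0̂) (0̂< p≢0̂)
    where
    go : ∀ x → Acc (λ a b → b < a) x → x < p → ∃[ q ] q ⋖ p
    go x (acc rs) x<p with between? x p
    ... | yes (i , x<z , z<p) = go (element i) (rs x<z) z<p
    ... | no none = x , x<p , λ z (x<z , z<p) →
      none (index z , subst (λ w → x < w × w < p) (sym (element-index z)) (x<z , z<p))

-- Characterisation of the toric polynomials

module Toric (Q : GradedPoset) where
  open GradedPoset Q
  open Sums Q

  toricF-∑ : ∀ {p d} → ρ p ≡ suc d → ∀ k →
             toricF Q p k ≡ ∑ₓ λ q → ⟦ q <? p ⟧ * D^ (d ∸ ρ q) (toricG Q q) k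
  toricF-∑ {p} {d} ρp≡ k = trans (cong (λ r → stanleyF Q r p (λ q _ → toricG Q q) k) ρp≡)
    (∑ₓ-cong λ q → trans (when-const (q <? p) ((toricG Q q ⊛ [X-1]^ (d ∸ ρ q)) k))
                          (cong (⟦ q <? p ⟧ *_) (⊛-D^ (d ∸ ρ q) (toricG Q q) k)))

  -- The sum on the right is that of Stanley's f, multiplied by x - 1 and
  -- extended by its term for q = p.

  D-toricF : ∀ {p} → p ≢ 0̂ → (G : Carrier → Poly) → (∀ q → q < p → toricG Q q ≗ G q) → ∀ k →
             D (toricF Q p) k + G p k ≡ ∑ₓ λ q → ζ q p * D^ (ρ p ∸ ρ q) (G q) k
  D-toricF {p} p≢0̂ G G≗ k with ρ-suc p≢0̂
  ... | d , ρp≡ = begin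
    D (toricF Q p) k + G p k
      ≡⟨ cong (_+ G p k) (D-cong (toricF-∑ ρp≡) k) ⟩
    D (λ k → ∑ₓ λ q → ⟦ q <? p ⟧ * D^ (d ∸ ρ q) (toricG Q q) k) k + G p k
      ≡⟨ cong (_+ G p k) (D-sum (λ i → ⟦ element i <? p ⟧) (λ i → D^ (d ∸ ρ (element i)) (toricG Q (element i))) k) ⟩
    ∑ₓ (λ q → ⟦ q <? p ⟧ * D (D^ (d ∸ ρ q) (toricG Q q)) k) + G p k
      ≡⟨ cong₂ _+_ (∑ₓ-cong λ q → ⟦⟧-*-cong (q <? p) (term q)) (cong (λ m → D^ m (G p) k) (sym (ℕ.n∸n≡0 (ρ p)))) ⟩
    ∑ₓ (λ q → ⟦ q <? p ⟧ * D^ (ρ p ∸ ρ q) (G q) k) + D^ (ρ p ∸ ρ p) (G p) k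
      ≡⟨ ∑ₓ-ζ-split p (λ q → D^ (ρ p ∸ ρ q) (G q) k) ⟨
    ∑ₓ (λ q → ζ q p * D^ (ρ p ∸ ρ q) (G q) k) ∎
    where
    term : ∀ q → q < p → D (D^ (d ∸ ρ q) (toricG Q q)) k ≡ D^ (ρ p ∸ ρ q) (G q) k
    term q q<p = begin
      D (D^ (d ∸ ρ q) (toricG Q q)) k   ≡⟨ cong (_$ k) (D-D^ (d ∸ ρ q) (toricG Q q)) ⟩
      D^ (suc (d ∸ ρ q)) (toricG Q q) k ≡⟨ cong (λ m → D^ m (toricG Q q) k) (ℕ.+-∸-assoc 1 ρq≤d) ⟨
      D^ (suc d ∸ ρ q) (toricG Q q) k   ≡⟨ cong (λ r → D^ (r ∸ ρ q) (toricG Q q) k) ρp≡ ⟨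
      D^ (ρ p ∸ ρ q) (toricG Q q) k     ≡⟨ D^-cong (ρ p ∸ ρ q) (G≗ q q<p) k ⟩
      D^ (ρ p ∸ ρ q) (G q) k            ∎
      where
      ρq≤d : ρ q ℕ.≤ d
      ρq≤d = ℕ.≤-pred (subst (ρ q ℕ.<_) ρp≡ (ρ-mono-< q<p))

  -- Differences of consecutive coefficients of f are the coefficients of (1 - x) f, and k ≤ ⌊d/2⌋
  -- amounts to 2k < r for r = d + 1.
  stanleyG-low : ∀ {r f k} → 2 ℕ.* k ℕ.< r → stanleyG r f k ≡ - D f k
  stanleyG-low {suc d} {f} {k} 2k<r = trans
    (monomials-∈ ⌊ d /2⌋ (λ i → f i - coeff-below f i) id k (≤⌊/2⌋ d k (ℕ.≤-pred 2k<r)) λ _ _ → id)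
    (flip-sub (f k) (coeff-below f k))
    where
    flip-sub : ∀ a b → a - b ≡ - (b - a)
    flip-sub = solve-∀

  stanleyG-high : ∀ {d f k} → suc d ℕ.≤ 2 ℕ.* k → stanleyG (suc d) f k ≡ 0ℤ
  stanleyG-high {d} {f} {k} d<2k = monomials-∉ ⌊ d /2⌋ (λ i → f i - coeff-below f i) id k
    λ j j≤ j≡k → ℕ.<⇒≱ d<2k (2*≤ d k (subst (ℕ._≤ ⌊ d /2⌋) j≡k j≤))

  -- Well-founded induction: once g agrees with `G` below p, `D-toricF` and `G-low` show that (1 -
  -- x) f([0̂,p)) agrees with `G p` in degrees below ρ(p)/2, which is exactly what Stanley's
  -- truncation keeps. The down-set `L` confines the argument to a part of the poset; for a dual
  -- poset it will omit the maximum.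
  module Characterization
    (L : Carrier → Set) (L-down : ∀ {q p} → q < p → L p → L q)
    (G : Carrier → Poly)
    (G-0̂ : G 0̂ ≗ 1ₚ)
    (G-high : ∀ p → L p → p ≢ 0̂ → ∀ k → ρ p ℕ.≤ 2 ℕ.* k → G p k ≡ 0ℤ)
    (G-low : ∀ p → L p → p ≢ 0̂ → ∀ k → 2 ℕ.* k ℕ.< ρ p →
             ∑ₓ (λ q → ζ q p * D^ (ρ p ∸ ρ q) (G q) k) ≡ 0ℤ)
    where

    D-toricF-low : ∀ {p} → L p → p ≢ 0̂ → (∀ q → q < p → toricG Q q ≗ G q) →
                   ∀ k → 2 ℕ.* k ℕ.< ρ p → - D (toricF Q p) k ≡ G p k
    D-toricF-low {p} Lp p≢0̂ G≗ k 2k<ρp = cancel (D (toricF Q p) k) (G p k)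
      (trans (D-toricF p≢0̂ G G≗ k) (G-low p Lp p≢0̂ k 2k<ρp))
      where
      cancel : ∀ a b → a + b ≡ 0ℤ → - a ≡ b
      cancel a b a+b≡0 = trans (regroup a b) (trans (cong (_-_ b) a+b≡0) (ℤ.+-identityʳ b))
        where
        regroup : ∀ a b → - a ≡ b - (a + b)
        regroup = solve-∀

    toricG≗G : ∀ p → L p → toricG Q p ≗ G p
    toricG≗G p = go p (<-wellFounded p)
      where
      go : ∀ p → Acc _<_ p → L p → toricG Q p ≗ G p
      go p (acc rs) Lp k with p ≟ 0̂
      ... | yes refl = trans (toricG-unfold Q 0̂ k)
              (trans (cong (λ r → stanleyG r (toricF Q 0̂) k) ρ-0̂) (sym (G-0̂ k)))
      ... | no p≢0̂ with 2 ℕ.* k ℕ.<? ρ p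
      ...   | yes 2k<ρp = trans (toricG-unfold Q p k) (trans (stanleyG-low {ρ p} {toricF Q p} {k} 2k<ρp)
                (D-toricF-low Lp p≢0̂ (λ q q<p → go q (rs q<p) (L-down q<p Lp)) k 2k<ρp))
      ...   | no 2k≮ρp with ρ-suc p≢0̂
      ...     | d , ρp≡ = trans (toricG-unfold Q p k) (trans
                (cong (λ r → stanleyG r (toricF Q p) k) ρp≡)
                (trans (stanleyG-high {d} {toricF Q p} {k} (subst (ℕ._≤ 2 ℕ.* k) ρp≡ (ℕ.≮⇒≥ 2k≮ρp)))
                       (sym (G-high p Lp p≢0̂ k (ℕ.≮⇒≥ 2k≮ρp)))))

    -D-toricF≡G : ∀ {p} → L p → p ≢ 0̂ → ∀ k → 2 ℕ.* k ℕ.< ρ p → - D (toricF Q p) k ≡ G p k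
    -D-toricF≡G Lp p≢0̂ = D-toricF-low Lp p≢0̂ λ q q<p → toricG≗G q (L-down q<p Lp)

  -- If [0̂,p] has the rank numbers of a Boolean algebra for all p in `L`, then g = 1 on `L`: the
  -- sum of (x - 1)^(ρ(p)-ρ(q)) over q ≤ p is x^ρ(p), which vanishes in degrees below ρ(p)/2.
  module LowerBoolean
    (L : Carrier → Set) (L-down : ∀ {q p} → q < p → L p → L q)
    (count : ∀ p → L p → ∀ F → ∑ₓ (λ q → ζ q p * F (ρ q)) ≡ B (ρ p) F)
    where

    1ₚ-high : ∀ p → L p → p ≢ 0̂ → ∀ k → ρ p ℕ.≤ 2 ℕ.* k → 1ₚ k ≡ 0ℤ
    1ₚ-high p _ p≢0̂ zero    ρp≤0 = contradiction (ℕ.≤-trans (ρ-mono-< (0̂< p≢0̂)) ρp≤0) λ ()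
    1ₚ-high p _ p≢0̂ (suc k) _    = refl

    1ₚ-low : ∀ p → L p → p ≢ 0̂ → ∀ k → 2 ℕ.* k ℕ.< ρ p → ∑ₓ (λ q → ζ q p * E (ρ p ∸ ρ q) k) ≡ 0ℤ
    1ₚ-low p Lp _ k 2k<ρp = begin
      ∑ₓ (λ q → ζ q p * E (ρ p ∸ ρ q) k) ≡⟨ count p Lp (λ j → E (ρ p ∸ j) k) ⟩
      B (ρ p) (λ j → E (ρ p ∸ j) k)      ≡⟨ B-reverse (ρ p) (λ j → E j k) ⟩
      B (ρ p) (λ j → E j k)              ≡⟨ B-D^ (ρ p) 1ₚ k ⟩
      shift (ρ p) 1ₚ k                   ≡⟨ shift-vanish (ρ p) 1ₚ {0} (λ _ ()) k
                                              (subst (2 ℕ.* k ℕ.<_) (sym (ℕ.+-identityʳ (ρ p))) 2k<ρp) ⟩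
      0ℤ ∎

    open Characterization L L-down (λ _ → 1ₚ) (λ _ → refl) 1ₚ-high 1ₚ-low public

-- Toric polynomials of Boolean algebras

module BooleanToric (m : ℕ) where
  open GradedPoset (boolean (suc m))
  open Sums (boolean (suc m))
  open Toric (boolean (suc m))

  count : ∀ T → ⊤ → ∀ F → ∑ₓ (λ S → ζ S T * F ∣ S ∣) ≡ B ∣ T ∣ F
  count T _ F = trans (∑ₓ-Subset id id (λ S → ζ S T * F ∣ S ∣) (λ S → inj₁ (S , refl))) (∑Subset-⊆ (suc m) T F)

  open LowerBoolean (λ _ → ⊤) (λ _ _ → tt) count

  -- Since g = 1, the polynomial (1 - x) f agrees with 1 in low degrees, so the coefficients of f up
  -- to the middle are the partial sums of 1, 0, 0, and so on.
  toricF-boolean : ∀ k → 2 ℕ.* k ℕ.≤ m → toricF (boolean (suc m)) 1̂ k ≡ 1ℤ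
  toricF-boolean k 2k≤m = trans (sub k) (rec k 2k≤m)
    where
    f = toricF (boolean (suc m)) 1̂
    unsub : ∀ a b → a ≡ b + - (b - a)
    unsub = solve-∀
    sub : ∀ k → f k ≡ coeff-below f k + - D f k
    sub k = unsub (f k) (coeff-below f k)
    1̂≢0̂ : 1̂ ≢ 0̂
    1̂≢0̂ ()
    rec : ∀ k → 2 ℕ.* k ℕ.≤ m → coeff-below f k + - D f k ≡ 1ℤ
    eq : ∀ k → 2 ℕ.* k ℕ.≤ m → - D f k ≡ 1ₚ k
    eq k 2k≤m = -D-toricF≡G tt 1̂≢0̂ k (subst (2 ℕ.* k ℕ.<_) (sym (∣⊤∣≡n (suc m))) (ℕ.s≤s 2k≤m))
    rec zero    2k≤m = trans (ℤ.+-identityˡ _) (eq 0 2k≤m)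
    rec (suc k) 2k≤m = trans (cong₂ _+_ (toricF-boolean k (ℕ.≤-trans (ℕ.*-monoʳ-≤ 2 (ℕ.n≤1+n k)) 2k≤m)) (eq (suc k) 2k≤m)) refl

-- Dual simplicial posets

module UpperInterval
  (P : GradedPoset) (s : GradedPoset.Carrier P)
  (isBoolean : IsBooleanAlgebra (interval P s (GradedPoset.1̂ P)))
  where

  open GradedPoset P
  open Sums P

  m : ℕ
  m = proj₁ isBoolean

  φ : ∃[ z ] (s ≤ z × z ≤ 1̂) → Subset m
  φ = proj₁ (proj₂ isBoolean)

  open IsOrderIsomorphism (proj₂ (proj₂ isBoolean)) renaming (cong to φ-cong)

  member : ∀ {x} → s ≤ x → ∃[ z ] (s ≤ z × z ≤ 1̂)
  member {x} s≤x = x , s≤x , 1̂-maximum x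

  ψ̂ : Subset m → ∃[ z ] (s ≤ z × z ≤ 1̂)
  ψ̂ S = proj₁ (surjective S)

  ψ : Subset m → Carrier
  ψ S = proj₁ (ψ̂ S)

  φψ : ∀ S → φ (ψ̂ S) ≡ S
  φψ S = proj₂ (surjective S) refl

  ψφ : ∀ {x} (s≤x : s ≤ x) → ψ (φ (member s≤x)) ≡ x
  ψφ s≤x = injective (φψ (φ (member s≤x)))

  s≤ψ : ∀ S → s ≤ ψ S
  s≤ψ S = proj₁ (proj₂ (ψ̂ S))

  ψ-mono : ∀ {S T} → S ⊆ T → ψ S ≤ ψ T
  ψ-mono {S} {T} S⊆T =
    cancel {ψ̂ S} {ψ̂ T} (subst₂ (λ S T → S ⊆ T) (sym (φψ S)) (sym (φψ T)) (λ {x} → S⊆T {x}))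

  ψ-cancel : ∀ {S T} → ψ S ≤ ψ T → S ⊆ T
  ψ-cancel {S} {T} ψS≤ψT {x} =
    subst₂ (λ S T → S ⊆ T) (φψ S) (φψ T) (λ {x} → mono {ψ̂ S} {ψ̂ T} ψS≤ψT {x}) {x}

  ψ-injective : ∀ {S T} → ψ S ≡ ψ T → S ≡ T
  ψ-injective {S} {T} ψS≡ψT = trans (sym (φψ S)) (trans (φ-cong {ψ̂ S} {ψ̂ T} ψS≡ψT) (φψ T))

  ψ⊥ : ψ Subset.⊥ ≡ s
  ψ⊥ = ≤-antisym (subst (ψ Subset.⊥ ≤_) (ψφ ≤-refl) (ψ-mono ⊥⊆)) (s≤ψ Subset.⊥)

  private module 𝔹 = GradedPoset (boolean m)

  -- An element strictly between ψ S and ψ T lies above s, hence comes from a subset strictly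
  -- between S and T.
  ψ-⋖ : ∀ {S T} → S 𝔹.⋖ T → ψ S ⋖ ψ T
  ψ-⋖ {S} {T} ((S⊆T , S≢T) , none) =
    (ψ-mono (λ {x} → S⊆T {x}) , S≢T ∘ ψ-injective) , λ z ((ψS≤z , ψS≢z) , (z≤ψT , z≢ψT)) →
      let s≤z = ≤-trans (s≤ψ S) ψS≤z
          U   = φ (member s≤z)
          ψU≡z = ψφ s≤z
      in none U
        ( ((λ {x} → ψ-cancel (subst (ψ S ≤_) (sym ψU≡z) ψS≤z) {x}) , λ S≡U → ψS≢z (trans (cong ψ S≡U) ψU≡z))
        , ((λ {x} → ψ-cancel (subst (_≤ ψ T) (sym ψU≡z) z≤ψT) {x}) , λ U≡T → z≢ψT (trans (sym ψU≡z) (cong ψ U≡T))))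

  -- Induction down a chain of covers to the empty set, whose image is s: `ψ` preserves covers, and
  -- both ranks grow by one at each cover.
  ρψ : ∀ S → ρ (ψ S) ≡ ρ s ℕ.+ ∣ S ∣
  ρψ S = go S (𝔹.<-wellFounded S)
    where
    go : ∀ S → Acc 𝔹._<_ S → ρ (ψ S) ≡ ρ s ℕ.+ ∣ S ∣
    go S (acc rs) with S 𝔹.≟ Subset.⊥
    ... | yes refl = trans (cong ρ ψ⊥) (sym (trans (cong (ρ s ℕ.+_) (∣⊥∣≡0 m)) (ℕ.+-identityʳ (ρ s))))
    ... | no S≢⊥ with Sums.lower-cover (boolean m) S≢⊥
    ...   | T , T⋖S = begin
      ρ (ψ S)             ≡⟨ ρ-⋖ (ψ-⋖ T⋖S) ⟩
      suc (ρ (ψ T))       ≡⟨ cong suc (go T (rs (proj₁ T⋖S))) ⟩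
      suc (ρ s ℕ.+ ∣ T ∣) ≡⟨ ℕ.+-suc (ρ s) ∣ T ∣ ⟨
      ρ s ℕ.+ suc ∣ T ∣   ≡⟨ cong (ρ s ℕ.+_) (𝔹.ρ-⋖ T⋖S) ⟨
      ρ s ℕ.+ ∣ S ∣       ∎

  -- Under the isomorphism [s,p] becomes the set of subsets of the image `T` of p, and `T` has ρ(p)
  -- - ρ(s) elements.
  ∑-interval-≤ : ∀ {p} → s ≤ p → ∀ (F : ℕ → ℤ) →
                 ∑ₓ (λ q → ζ s q * (ζ q p * F (ρ q))) ≡ B (ρ p ∸ ρ s) (λ j → F (ρ s ℕ.+ j))
  ∑-interval-≤ {p} s≤p F = begin
    ∑ₓ (λ q → ζ s q * (ζ q p * F (ρ q)))
      ≡⟨ ∑ₓ-Subset ψ ψ-injective _ (λ x → image x (s ≤? x)) ⟩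
    ∑Subset m (λ S → ζ s (ψ S) * (ζ (ψ S) p * F (ρ (ψ S))))
      ≡⟨ ∑Subset-cong m (λ S → trans (cong (_* (ζ (ψ S) p * F (ρ (ψ S)))) (⟦⟧-yes (s ≤? ψ S) (s≤ψ S)))
           (trans (ℤ.*-identityˡ (ζ (ψ S) p * F (ρ (ψ S)))) (cong₂ _*_ (⟦⟧-iff (ψ S ≤? p) (S ⊆? T) (to S) (from S)) (cong F (ρψ S))))) ⟩
    ∑Subset m (λ S → ⟦ S ⊆? T ⟧ * F (ρ s ℕ.+ ∣ S ∣))
      ≡⟨ ∑Subset-⊆ m T (λ j → F (ρ s ℕ.+ j)) ⟩
    B ∣ T ∣ (λ j → F (ρ s ℕ.+ j))
      ≡⟨ cong (λ i → B i (λ j → F (ρ s ℕ.+ j))) ∣T∣≡ ⟩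
    B (ρ p ∸ ρ s) (λ j → F (ρ s ℕ.+ j)) ∎
    where
    T = φ (member s≤p)
    to : ∀ S → ψ S ≤ p → S ⊆ T
    to S ψS≤p {x} = ψ-cancel (subst (ψ S ≤_) (sym (ψφ s≤p)) ψS≤p) {x}
    from : ∀ S → S ⊆ T → ψ S ≤ p
    from S S⊆T = subst (ψ S ≤_) (ψφ s≤p) (ψ-mono (λ {x} → S⊆T {x}))
    ∣T∣≡ : ∣ T ∣ ≡ ρ p ∸ ρ s
    ∣T∣≡ = sym (trans (cong (_∸ ρ s) (trans (cong ρ (sym (ψφ s≤p))) (ρψ T))) (ℕ.m+n∸m≡n (ρ s) ∣ T ∣))
    image : ∀ x → Dec (s ≤ x) → (∃[ S ] ψ S ≡ x) ⊎ ζ s x * (ζ x p * F (ρ x)) ≡ 0ℤ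
    image x (yes s≤x) = inj₁ (φ (member s≤x) , ψφ s≤x)
    image x (no s≰x)  = inj₂ (cong (_* (ζ x p * F (ρ x))) (⟦⟧-no (s ≤? x) s≰x))

-- Solution of Stanley's recursion for dual simplicial Eulerian posets

module DualSimplicialEulerian (P : GradedPoset) (eulerian : Eulerian P) (dualSimplicial : DualSimplicial P) where
  open GradedPoset P
  open Sums P

  nz : Carrier → ℤ
  nz q = ⟦ ¬? (q ≟ 0̂) ⟧

  nz-* : ∀ q {x y} → (q ≢ 0̂ → x ≡ y) → nz q * x ≡ nz q * y
  nz-* q = ⟦⟧-*-cong (¬? (q ≟ 0̂))

  nz≡1 : ∀ {q} → q ≢ 0̂ → nz q ≡ 1ℤ
  nz≡1 {q} = ⟦⟧-yes (¬? (q ≟ 0̂))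

  above≢0̂ : ∀ {q p} → q ≢ 0̂ → q ≤ p → p ≢ 0̂
  above≢0̂ q≢0̂ q≤0̂ refl = q≢0̂ (≤-antisym q≤0̂ (0̂-minimum _))

  ∑-interval : ∀ {s} → s ≢ 0̂ → ∀ p (F : ℕ → ℤ) →
               ∑ₓ (λ q → ζ s q * (ζ q p * F (ρ q))) ≡ ζ s p * B (ρ p ∸ ρ s) (λ j → F (ρ s ℕ.+ j))
  ∑-interval {s} s≢0̂ p F = go (s ≤? p)
    where
    go : Dec (s ≤ p) → ∑ₓ (λ q → ζ s q * (ζ q p * F (ρ q))) ≡ ζ s p * B (ρ p ∸ ρ s) (λ j → F (ρ s ℕ.+ j))
    go (yes s≤p) = trans (UpperInterval.∑-interval-≤ P s (dualSimplicial s s≢0̂) s≤p F)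
      (sym (trans (cong (_* B (ρ p ∸ ρ s) (λ j → F (ρ s ℕ.+ j))) (⟦⟧-yes (s ≤? p) s≤p)) (ℤ.*-identityˡ _)))
    go (no s≰p) = trans
      (sum-zero λ i → ⟦⟧-*-zero (s ≤? element i) λ s≤q → ⟦⟧-*-zero (element i ≤? p) λ q≤p →
        contradiction (≤-trans s≤q q≤p) s≰p)
      (sym (cong (_* B (ρ p ∸ ρ s) (λ j → F (ρ s ℕ.+ j))) (⟦⟧-no (s ≤? p) s≰p)))

  -- The binomial theorem on the Boolean interval [s,p]: the powers (x - 1)^(ρ(q)-ρ(s)) add up to
  -- x^(ρ(p)-ρ(s)).
  ∑-interval-D^ : ∀ {s} → s ≢ 0̂ → ∀ p x k →
                  ∑ₓ (λ q → ζ s q * (ζ q p * D^ (ρ q ∸ ρ s) x k)) ≡ ζ s p * shift (ρ p ∸ ρ s) x k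
  ∑-interval-D^ {s} s≢0̂ p x k = begin
    ∑ₓ (λ q → ζ s q * (ζ q p * D^ (ρ q ∸ ρ s) x k))
      ≡⟨ ∑-interval s≢0̂ p (λ r → D^ (r ∸ ρ s) x k) ⟩
    ζ s p * B (ρ p ∸ ρ s) (λ j → D^ (ρ s ℕ.+ j ∸ ρ s) x k)
      ≡⟨ cong (ζ s p *_) (B-cong (ρ p ∸ ρ s) λ j _ → cong (λ i → D^ i x k) (ℕ.m+n∸m≡n (ρ s) j)) ⟩
    ζ s p * B (ρ p ∸ ρ s) (λ j → D^ j x k)
      ≡⟨ cong (ζ s p *_) (B-D^ (ρ p ∸ ρ s) x k) ⟩
    ζ s p * shift (ρ p ∸ ρ s) x k ∎

  -- Here the exponents count down from p; complementation in the Boolean interval leads to the same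
  -- power of x.
  ∑-interval-D^ʳ : ∀ {s} → s ≢ 0̂ → ∀ p x k →
                   ∑ₓ (λ q → ζ s q * (ζ q p * D^ (ρ p ∸ ρ q) x k)) ≡ ζ s p * shift (ρ p ∸ ρ s) x k
  ∑-interval-D^ʳ {s} s≢0̂ p x k = begin
    ∑ₓ (λ q → ζ s q * (ζ q p * D^ (ρ p ∸ ρ q) x k))
      ≡⟨ ∑-interval s≢0̂ p (λ r → D^ (ρ p ∸ r) x k) ⟩
    ζ s p * B (ρ p ∸ ρ s) (λ j → D^ (ρ p ∸ (ρ s ℕ.+ j)) x k)
      ≡⟨ cong (ζ s p *_) (B-cong (ρ p ∸ ρ s) λ j _ → cong (λ i → D^ i x k) (sym (ℕ.∸-+-assoc (ρ p) (ρ s) j))) ⟩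
    ζ s p * B (ρ p ∸ ρ s) (λ j → D^ (ρ p ∸ ρ s ∸ j) x k)
      ≡⟨ cong (ζ s p *_) (B-reverse (ρ p ∸ ρ s) (λ j → D^ j x k)) ⟩
    ζ s p * B (ρ p ∸ ρ s) (λ j → D^ j x k)
      ≡⟨ cong (ζ s p *_) (B-D^ (ρ p ∸ ρ s) x k) ⟩
    ζ s p * shift (ρ p ∸ ρ s) x k ∎

  ∑-nz : ∀ (F : Carrier → ℤ) → ∑ₓ (λ q → nz q * F q) ≡ ∑ₓ F - F 0̂
  ∑-nz F = trans (∑ₓ-cong λ q → pointwise q (q ≟ 0̂)) (trans
    (sum-sub (F ∘ element) (λ i → ⟦ element i ≟ 0̂ ⟧ * F (element i)))
    (cong (_-_ (∑ₓ F)) (trans (∑ₓ-single 0̂ λ q q≢0̂ → cong (_* F q) (⟦⟧-no (q ≟ 0̂) q≢0̂))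
      (trans (cong (_* F 0̂) (⟦⟧-yes (0̂ ≟ 0̂) refl)) (ℤ.*-identityˡ (F 0̂))))))
    where
    cancel : ∀ a → 0ℤ ≡ a - 1ℤ * a
    cancel = solve-∀
    keep : ∀ a → 1ℤ * a ≡ a - 0ℤ * a
    keep = solve-∀
    pointwise : ∀ q → Dec (q ≡ 0̂) → nz q * F q ≡ F q - ⟦ q ≟ 0̂ ⟧ * F q
    pointwise q (yes q≡0̂) = begin
      nz q * F q               ≡⟨ cong (_* F q) (⟦⟧-no (¬? (q ≟ 0̂)) (_$ q≡0̂)) ⟩
      0ℤ                       ≡⟨ cancel (F q) ⟩
      F q - 1ℤ * F q           ≡⟨ cong (λ z → F q - z * F q) (⟦⟧-yes (q ≟ 0̂) q≡0̂) ⟨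
      F q - ⟦ q ≟ 0̂ ⟧ * F q    ∎
    pointwise q (no q≢0̂) = begin
      nz q * F q               ≡⟨ cong (_* F q) (nz≡1 q≢0̂) ⟩
      1ℤ * F q                 ≡⟨ keep (F q) ⟩
      F q - 0ℤ * F q           ≡⟨ cong (λ z → F q - z * F q) (⟦⟧-no (q ≟ 0̂) q≢0̂) ⟨
      F q - ⟦ q ≟ 0̂ ⟧ * F q    ∎

  sg : ℕ → ℤ
  sg r = -1ℤ ^ r

  -- The Eulerian relation of [0̂,p] with the term 1 of 0̂ removed.
  euler : ∀ {p} → p ≢ 0̂ → ∑ₓ (λ q → nz q * (ζ q p * sg (ρ q))) ≡ -1ℤ
  euler {p} p≢0̂ = begin
    ∑ₓ (λ q → nz q * (ζ q p * sg (ρ q))) ≡⟨ ∑-nz (λ q → ζ q p * sg (ρ q)) ⟩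
    ∑ₓ (λ q → ζ q p * sg (ρ q)) - ζ 0̂ p * sg (ρ 0̂)
      ≡⟨ cong₂ _-_ whole (cong₂ _*_ (⟦⟧-yes (0̂ ≤? p) (0̂-minimum p)) (cong sg ρ-0̂)) ⟩
    -1ℤ ∎
    where
    whole : ∑ₓ (λ q → ζ q p * sg (ρ q)) ≡ 0ℤ
    whole = trans (∑ₓ-cong λ q → sym (trans
      (when-const ((0̂ ≤? q) ×-dec (q ≤? p)) (sg (ρ q)))
      (cong (_* sg (ρ q)) (⟦⟧-iff ((0̂ ≤? q) ×-dec (q ≤? p)) (q ≤? p) proj₂ (0̂-minimum q ,_)))))
      (eulerian 0̂ p (0̂< p≢0̂))

  -- K s is (x - 1) times the h-polynomial of the dual of [0̂,s].

  K : Carrier → Poly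
  K s k = ∑ₓ λ q → (nz q * ζ q s) * E (ρ q) k

  -- The sign (-1)^ρ(s) is included, together with the truncation below degree ρ(s)/2.
  γ : Carrier → Poly
  γ s k = sg (ρ s) * (⟦ 2 ℕ.* k ℕ.<? ρ s ⟧ * K s k)

  -- The first summand supplies the value 1 at 0̂, where the sum has no nonzero term.
  G : Carrier → Poly
  G p k = ⟦ p ≟ 0̂ ⟧ * 1ₚ k + ∑ₓ λ s → (nz s * ζ s p) * γ s k

  -- Everything above an element other than 0̂ is other than 0̂. Dropping the indicator of s turns a
  -- sum over s into one over a full Boolean interval starting at q.
  nz-absorb : ∀ q s x → nz s * (nz q * (ζ q s * x)) ≡ nz q * (ζ q s * x)
  nz-absorb q s x = go (s ≟ 0̂) (q ≟ 0̂) (q ≤? s)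
    where
    go : Dec (s ≡ 0̂) → Dec (q ≡ 0̂) → Dec (q ≤ s) → nz s * (nz q * (ζ q s * x)) ≡ nz q * (ζ q s * x)
    go (no s≢0̂) _ _ = trans (cong (_* (nz q * (ζ q s * x))) (nz≡1 s≢0̂)) (ℤ.*-identityˡ _)
    go (yes _) (yes q≡0̂) _ rewrite ⟦⟧-no (¬? (q ≟ 0̂)) (_$ q≡0̂) = ℤ.*-zeroʳ (nz s)
    go (yes _) _ (no q≰s) rewrite ⟦⟧-no (q ≤? s) q≰s | ℤ.*-zeroʳ (nz q) = ℤ.*-zeroʳ (nz s)
    go (yes refl) (no q≢0̂) (yes q≤s) = contradiction refl (above≢0̂ q≢0̂ q≤s)

  -- x^(ρ(p)-ρ(s)) is summed with signs against the inner index q of K s, which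
  -- turns it into (x - 1)^(ρ(p)-ρ(q)), and leaves the Euler characteristic.

  E-top : ∀ {p} → p ≢ 0̂ → ∀ k →
          ∑ₓ (λ s → nz s * (ζ s p * (sg (ρ s) * shift (ρ p ∸ ρ s) (K s) k))) ≡ - E (ρ p) k
  E-top {p} p≢0̂ k = begin
    ∑ₓ (λ s → nz s * (ζ s p * (sg (ρ s) * shift (ρ p ∸ ρ s) (K s) k)))
      ≡⟨ ∑ₓ-cong (λ s → trans (assoc (nz s) (ζ s p) (sg (ρ s)) _)
           (cong (nz s * ζ s p * sg (ρ s) *_)
             (shift-sum (ρ p ∸ ρ s) (λ i → nz (element i) * ζ (element i) s) (λ i → E (ρ (element i))) k))) ⟩
    ∑ₓ (λ s → nz s * ζ s p * sg (ρ s) * ∑ₓ λ q → (nz q * ζ q s) * shift (ρ p ∸ ρ s) (E (ρ q)) k)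
      ≡⟨ ∑ₓ-swap (λ s → nz s * ζ s p * sg (ρ s)) (λ s q → (nz q * ζ q s) * shift (ρ p ∸ ρ s) (E (ρ q)) k) ⟩
    ∑ₓ (λ q → ∑ₓ λ s → nz s * ζ s p * sg (ρ s) * ((nz q * ζ q s) * shift (ρ p ∸ ρ s) (E (ρ q)) k))
      ≡⟨ ∑ₓ-cong inner ⟩
    ∑ₓ (λ q → (nz q * (ζ q p * sg (ρ q))) * E (ρ p) k)
      ≡⟨ sum-*ʳ (λ i → nz (element i) * (ζ (element i) p * sg (ρ (element i)))) (E (ρ p) k) ⟩
    ∑ₓ (λ q → nz q * (ζ q p * sg (ρ q))) * E (ρ p) k
      ≡⟨ trans (cong (_* E (ρ p) k) (euler p≢0̂)) (ℤ.-1*i≡-i _) ⟩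
    - E (ρ p) k ∎
    where
    assoc : ∀ a b c d → a * (b * (c * d)) ≡ a * b * c * d
    assoc = solve-∀
    rearrange : ∀ a b c d e f → a * b * c * ((d * e) * f) ≡ a * (d * (e * (b * (c * f))))
    rearrange = solve-∀
    term : Carrier → ℕ → ℤ
    term q r = sg r * shift (ρ p ∸ r) (E (ρ q)) k
    collapse : ∀ q → q ≤ p → B (ρ p ∸ ρ q) (λ j → term q (ρ q ℕ.+ j)) ≡ sg (ρ q) * E (ρ p) k
    collapse q q≤p = begin
      B (ρ p ∸ ρ q) (λ j → term q (ρ q ℕ.+ j))
        ≡⟨ B-cong (ρ p ∸ ρ q) (λ j _ → trans
             (cong₂ _*_ (ℤ.^-distribˡ-+-* -1ℤ (ρ q) j)
                        (cong (λ i → shift i (E (ρ q)) k) (sym (ℕ.∸-+-assoc (ρ p) (ρ q) j))))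
             (ℤ.*-assoc (sg (ρ q)) (sg j) _)) ⟩
      B (ρ p ∸ ρ q) (λ j → sg (ρ q) * (sg j * shift (ρ p ∸ ρ q ∸ j) (E (ρ q)) k))
        ≡⟨ B-* (ρ p ∸ ρ q) (sg (ρ q)) (λ j → sg j * shift (ρ p ∸ ρ q ∸ j) (E (ρ q)) k) ⟩
      sg (ρ q) * B (ρ p ∸ ρ q) (λ j → sg j * shift (ρ p ∸ ρ q ∸ j) (E (ρ q)) k)
        ≡⟨ cong (sg (ρ q) *_) (B-shift (ρ p ∸ ρ q) (E (ρ q)) k) ⟩
      sg (ρ q) * D^ (ρ p ∸ ρ q) (E (ρ q)) k
        ≡⟨ cong (λ e → sg (ρ q) * e k) (trans (D^-+ (ρ q) (ρ p ∸ ρ q) 1ₚ) (cong E (ℕ.m+[n∸m]≡n (ρ-mono-≤ q≤p)))) ⟩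
      sg (ρ q) * E (ρ p) k ∎
    inner : ∀ q → ∑ₓ (λ s → nz s * ζ s p * sg (ρ s) * ((nz q * ζ q s) * shift (ρ p ∸ ρ s) (E (ρ q)) k))
                  ≡ (nz q * (ζ q p * sg (ρ q))) * E (ρ p) k
    inner q = begin
      ∑ₓ (λ s → nz s * ζ s p * sg (ρ s) * ((nz q * ζ q s) * shift (ρ p ∸ ρ s) (E (ρ q)) k))
        ≡⟨ ∑ₓ-cong (λ s → trans (rearrange (nz s) (ζ s p) (sg (ρ s)) (nz q) (ζ q s) _)
                                (nz-absorb q s (ζ s p * term q (ρ s)))) ⟩
      ∑ₓ (λ s → nz q * (ζ q s * (ζ s p * term q (ρ s))))
        ≡⟨ ∑ₓ-* (nz q) (λ s → ζ q s * (ζ s p * term q (ρ s))) ⟩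
      nz q * ∑ₓ (λ s → ζ q s * (ζ s p * term q (ρ s)))
        ≡⟨ nz-* q (λ q≢0̂ → trans (∑-interval q≢0̂ p (term q)) (⟦⟧-*-cong (q ≤? p) (collapse q))) ⟩
      nz q * (ζ q p * (sg (ρ q) * E (ρ p) k))
        ≡⟨ assoc′ (nz q) (ζ q p) (sg (ρ q)) (E (ρ p) k) ⟩
      (nz q * (ζ q p * sg (ρ q))) * E (ρ p) k ∎
      where
      assoc′ : ∀ a b c d → a * (b * (c * d)) ≡ (a * (b * c)) * d
      assoc′ = solve-∀

  D^-G : ∀ m q k → D^ m (G q) k ≡ ⟦ q ≟ 0̂ ⟧ * E m k + ∑ₓ λ s → (nz s * ζ s q) * D^ m (γ s) k
  D^-G m q k = trans (D^-⊕ m (⟦ q ≟ 0̂ ⟧ · 1ₚ) (λ k → ∑ₓ λ s → (nz s * ζ s q) * γ s k) k)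
    (cong₂ _+_ (D^-* m ⟦ q ≟ 0̂ ⟧ 1ₚ k)
               (D^-sum m (λ i → nz (element i) * ζ (element i) q) (γ ∘ element) k))

  -- The summand of 0̂ contributes (x - 1)^ρ(p). Each s ≠ 0̂ contributes x^(ρ(p)-ρ(s)) γ_s because
  -- [s,p] is Boolean; in these degrees γ_s may be replaced by its untruncated form, and `E-top`
  -- then yields the opposite of (x - 1)^ρ(p).
  G-low : ∀ p → p ≢ 0̂ → ∀ k → 2 ℕ.* k ℕ.< ρ p → ∑ₓ (λ q → ζ q p * D^ (ρ p ∸ ρ q) (G q) k) ≡ 0ℤ
  G-low p p≢0̂ k 2k<ρp = begin
    ∑ₓ (λ q → ζ q p * D^ (ρ p ∸ ρ q) (G q) k)
      ≡⟨ ∑ₓ-cong (λ q → trans (cong (ζ q p *_) (D^-G (ρ p ∸ ρ q) q k)) (distrib (ζ q p) ⟦ q ≟ 0̂ ⟧ _ _)) ⟩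
    ∑ₓ (λ q → ⟦ q ≟ 0̂ ⟧ * (ζ q p * E (ρ p ∸ ρ q) k) + ζ q p * ∑ₓ λ s → (nz s * ζ s q) * D^ (ρ p ∸ ρ q) (γ s) k)
      ≡⟨ ∑ₓ-+ (λ q → ⟦ q ≟ 0̂ ⟧ * (ζ q p * E (ρ p ∸ ρ q) k)) (λ q → ζ q p * ∑ₓ λ s → (nz s * ζ s q) * D^ (ρ p ∸ ρ q) (γ s) k) ⟩
    ∑ₓ (λ q → ⟦ q ≟ 0̂ ⟧ * (ζ q p * E (ρ p ∸ ρ q) k)) + ∑ₓ (λ q → ζ q p * ∑ₓ λ s → (nz s * ζ s q) * D^ (ρ p ∸ ρ q) (γ s) k)
      ≡⟨ cong₂ _+_ bottom (trans (∑ₓ-swap (λ q → ζ q p) (λ q s → (nz s * ζ s q) * D^ (ρ p ∸ ρ q) (γ s) k)) (∑ₓ-cong above)) ⟩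
    E (ρ p) k + ∑ₓ (λ s → nz s * (ζ s p * shift (ρ p ∸ ρ s) (γ s) k))
      ≡⟨ cong (_+_ (E (ρ p) k)) (∑ₓ-cong λ s → cong (nz s *_) (⟦⟧-*-cong (s ≤? p) (truncate s))) ⟩
    E (ρ p) k + ∑ₓ (λ s → nz s * (ζ s p * (sg (ρ s) * shift (ρ p ∸ ρ s) (K s) k)))
      ≡⟨ cong (_+_ (E (ρ p) k)) (E-top p≢0̂ k) ⟩
    E (ρ p) k - E (ρ p) k ≡⟨ ℤ.+-inverseʳ (E (ρ p) k) ⟩
    0ℤ ∎
    where
    distrib : ∀ a b c d → a * (b * c + d) ≡ b * (a * c) + a * d
    distrib = solve-∀
    bottom : ∑ₓ (λ q → ⟦ q ≟ 0̂ ⟧ * (ζ q p * E (ρ p ∸ ρ q) k)) ≡ E (ρ p) k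
    bottom = begin
      ∑ₓ (λ q → ⟦ q ≟ 0̂ ⟧ * (ζ q p * E (ρ p ∸ ρ q) k))
        ≡⟨ ∑ₓ-single 0̂ (λ q q≢0̂ → cong (_* (ζ q p * E (ρ p ∸ ρ q) k)) (⟦⟧-no (q ≟ 0̂) q≢0̂)) ⟩
      ⟦ 0̂ ≟ 0̂ ⟧ * (ζ 0̂ p * E (ρ p ∸ ρ 0̂) k)
        ≡⟨ cong₂ (λ a b → a * (b * E (ρ p ∸ ρ 0̂) k)) (⟦⟧-yes (0̂ ≟ 0̂) refl) (⟦⟧-yes (0̂ ≤? p) (0̂-minimum p)) ⟩
      1ℤ * (1ℤ * E (ρ p ∸ ρ 0̂) k)
        ≡⟨ trans (ℤ.*-identityˡ _) (ℤ.*-identityˡ _) ⟩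
      E (ρ p ∸ ρ 0̂) k ≡⟨ cong (λ r → E (ρ p ∸ r) k) ρ-0̂ ⟩
      E (ρ p) k ∎
    above : ∀ s → ∑ₓ (λ q → ζ q p * ((nz s * ζ s q) * D^ (ρ p ∸ ρ q) (γ s) k))
                  ≡ nz s * (ζ s p * shift (ρ p ∸ ρ s) (γ s) k)
    above s = begin
      ∑ₓ (λ q → ζ q p * ((nz s * ζ s q) * D^ (ρ p ∸ ρ q) (γ s) k))
        ≡⟨ ∑ₓ-cong (λ q → rearrange (ζ q p) (nz s) (ζ s q) (D^ (ρ p ∸ ρ q) (γ s) k)) ⟩
      ∑ₓ (λ q → nz s * (ζ s q * (ζ q p * D^ (ρ p ∸ ρ q) (γ s) k)))
        ≡⟨ ∑ₓ-* (nz s) (λ q → ζ s q * (ζ q p * D^ (ρ p ∸ ρ q) (γ s) k)) ⟩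
      nz s * ∑ₓ (λ q → ζ s q * (ζ q p * D^ (ρ p ∸ ρ q) (γ s) k))
        ≡⟨ nz-* s (λ s≢0̂ → ∑-interval-D^ʳ s≢0̂ p (γ s) k) ⟩
      nz s * (ζ s p * shift (ρ p ∸ ρ s) (γ s) k) ∎
      where
      rearrange : ∀ a b c d → a * ((b * c) * d) ≡ b * (c * (a * d))
      rearrange = solve-∀
    -- The terms cut from γ_s have degree at least ρ(s)/2; after multiplication by x^(ρ(p)-ρ(s))
    -- they have degree at least ρ(p)/2 and are invisible here.
    truncate : ∀ s → s ≤ p → shift (ρ p ∸ ρ s) (γ s) k ≡ sg (ρ s) * shift (ρ p ∸ ρ s) (K s) k
    truncate s s≤p = begin
      shift m (γ s) k ≡⟨ split (shift m (γ s) k) (sg (ρ s)) (shift m (K s) k) ⟩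
      shift m (γ s) k + - sg (ρ s) * shift m (K s) k + sg (ρ s) * shift m (K s) k
        ≡⟨ cong (λ z → shift m (γ s) k + z + sg (ρ s) * shift m (K s) k) (shift-* m (- sg (ρ s)) (K s) k) ⟨
      shift m (γ s) k + shift m ((- sg (ρ s)) · K s) k + sg (ρ s) * shift m (K s) k
        ≡⟨ cong (_+ sg (ρ s) * shift m (K s) k) (trans (shift-+ m (γ s) ((- sg (ρ s)) · K s) k)
             (shift-vanish m (γ s ⊕ (- sg (ρ s)) · K s) {ρ s} vanish k
               (subst (2 ℕ.* k ℕ.<_) (sym (ℕ.m∸n+n≡m (ρ-mono-≤ s≤p))) 2k<ρp))) ⟩
      0ℤ + sg (ρ s) * shift m (K s) k ≡⟨ ℤ.+-identityˡ _ ⟩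
      sg (ρ s) * shift m (K s) k ∎
      where
      m = ρ p ∸ ρ s
      split : ∀ a b c → a ≡ a + - b * c + b * c
      split = solve-∀
      cancel : ∀ a b → a * (1ℤ * b) + - a * b ≡ 0ℤ
      cancel = solve-∀
      vanish : ∀ k → 2 ℕ.* k ℕ.< ρ s → (γ s ⊕ (- sg (ρ s)) · K s) k ≡ 0ℤ
      vanish k 2k<ρs = trans
        (cong (λ z → sg (ρ s) * (z * K s k) + - sg (ρ s) * K s k) (⟦⟧-yes (2 ℕ.* k ℕ.<? ρ s) 2k<ρs))
        (cancel (sg (ρ s)) (K s k))

  -- Each summand is cut off at half the rank of some s ≤ p.
  G-high : ∀ p → p ≢ 0̂ → ∀ k → ρ p ℕ.≤ 2 ℕ.* k → G p k ≡ 0ℤ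
  G-high p p≢0̂ k ρp≤2k = cong₂ _+_ (cong (_* 1ₚ k) (⟦⟧-no (p ≟ 0̂) p≢0̂))
    (sum-zero λ i → trans (ℤ.*-assoc (nz (element i)) (ζ (element i) p) _)
      (trans (cong (nz (element i) *_) (⟦⟧-*-zero (element i ≤? p) (high (element i)))) (ℤ.*-zeroʳ (nz (element i)))))
    where
    high : ∀ s → s ≤ p → γ s k ≡ 0ℤ
    high s s≤p = trans (cong (λ z → sg (ρ s) * (z * K s k))
      (⟦⟧-no (2 ℕ.* k ℕ.<? ρ s) (ℕ.≤⇒≯ (ℕ.≤-trans (ρ-mono-≤ s≤p) ρp≤2k)))) (ℤ.*-zeroʳ (sg (ρ s)))

  G-0̂ : G 0̂ ≗ 1ₚ
  G-0̂ k = trans (cong₂ _+_ (trans (cong (_* 1ₚ k) (⟦⟧-yes (0̂ ≟ 0̂) refl)) (ℤ.*-identityˡ (1ₚ k)))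
    (sum-zero λ i → trans (ℤ.*-assoc (nz (element i)) (ζ (element i) 0̂) _)
      (⟦⟧-*-zero (¬? (element i ≟ 0̂)) λ q≢0̂ → ⟦⟧-*-zero (element i ≤? 0̂) λ q≤0̂ →
        contradiction refl (above≢0̂ q≢0̂ q≤0̂))))
    (ℤ.+-identityʳ (1ₚ k))

-- From the f-vector to the h-vector

binomial : ℕ → ℕ → ℤ
binomial l k = + (l C k)

-- A set of l elements has C(l,k) subsets of size k; the induction is Pascal's rule.
B-δ : ∀ l k (F : ℕ → ℤ) → B l (λ t → ⟦ t ℕ.≟ k ⟧ * F t) ≡ binomial l k * F k
B-δ zero    zero    F = refl
B-δ zero    (suc k) F = sym (cong (λ c → + c * F (suc k)) (k>n⇒nCk≡0 (ℕ.s≤s (ℕ.z≤n {k}))))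
B-δ (suc l) zero    F = begin
  B l (λ t → ⟦ t ℕ.≟ 0 ⟧ * F t) + B l (λ t → ⟦ suc t ℕ.≟ 0 ⟧ * F (suc t))
    ≡⟨ cong₂ _+_ (B-δ l 0 F) (B-zero l) ⟩
  binomial l 0 * F 0 + 0ℤ ≡⟨ ℤ.+-identityʳ _ ⟩
  binomial (suc l) 0 * F 0 ∎
B-δ (suc l) (suc k) F = begin
  B l (λ t → ⟦ t ℕ.≟ suc k ⟧ * F t) + B l (λ t → ⟦ suc t ℕ.≟ suc k ⟧ * F (suc t))
    ≡⟨ cong₂ _+_ (B-δ l (suc k) F) (trans
         (B-cong l λ t _ → cong (_* F (suc t)) (⟦⟧-iff (suc t ℕ.≟ suc k) (t ℕ.≟ k) ℕ.suc-injective (cong suc)))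
         (B-δ l k (F ∘ suc))) ⟩
  binomial l (suc k) * F (suc k) + binomial l k * F (suc k)
    ≡⟨ ℤ.*-distribʳ-+ (F (suc k)) (binomial l (suc k)) (binomial l k) ⟨
  + (l C suc k ℕ.+ l C k) * F (suc k)
    ≡⟨ cong (λ c → + c * F (suc k)) (trans (ℕ.+-comm (l C suc k) (l C k)) (nCk+nC[k+1]≡[n+1]C[k+1] l k)) ⟩
  binomial (suc l) (suc k) * F (suc k) ∎

shift-1ₚ : ∀ t k → shift t 1ₚ k ≡ ⟦ t ℕ.≟ k ⟧
shift-1ₚ zero    zero    = refl
shift-1ₚ zero    (suc k) = refl
shift-1ₚ (suc t) zero    = refl
shift-1ₚ (suc t) (suc k) = trans (shift-1ₚ t k)
  (⟦⟧-iff (t ℕ.≟ k) (suc t ℕ.≟ suc k) (cong suc) ℕ.suc-injective)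

-- Newton's forward difference formula, E i l being (-1)ⁱ⁻ˡ C(i,l).

newton : ∀ {n} (K : ℕ → ℕ → ℤ) → (∀ i j → i ℕ.+ j ℕ.< n → K (suc i) j ≡ K i (suc j) - K i j) →
         ∀ N i j → i ℕ.≤ N → i ℕ.+ j ℕ.≤ n → K i j ≡ ∑< (suc N) λ l → E i l * K 0 (l ℕ.+ j)
newton K rec N zero j _ _ = sym (trans
  (∑<-single (suc N) {λ l → 1ₚ l * K 0 (l ℕ.+ j)} 0 ℕ.z<s λ { zero 0≢0 → contradiction refl 0≢0 ; (suc l) _ → refl })
  (ℤ.*-identityˡ _))
newton {n} K rec (suc N) (suc i) j (ℕ.s≤s i≤N) i+j<n = begin
  K (suc i) j ≡⟨ rec i j i+j<n ⟩
  K i (suc j) - K i j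
    -- The first expansion stops at N and the second at N + 1, so that shifting the index of the
    -- first by one aligns the two ranges.
    ≡⟨ cong₂ _-_ (newton K rec N i (suc j) i≤N (subst (ℕ._≤ n) (sym (ℕ.+-suc i j)) i+j<n))
                 (newton K rec (suc N) i j (ℕ.m≤n⇒m≤1+n i≤N) (ℕ.<⇒≤ i+j<n)) ⟩
  ∑< (suc N) (λ l → E i l * K 0 (l ℕ.+ suc j)) - ∑< (suc (suc N)) (λ l → E i l * K 0 (l ℕ.+ j))
    ≡⟨ cong (_- ∑< (suc (suc N)) (λ l → E i l * K 0 (l ℕ.+ j))) (trans
         (∑<-cong (suc N) λ l _ → cong (λ m → E i l * K 0 m) (ℕ.+-suc l j)) (sym (ℤ.+-identityˡ _))) ⟩
  ∑< (suc (suc N)) (λ l → coeff-below (E i) l * K 0 (l ℕ.+ j)) - ∑< (suc (suc N)) (λ l → E i l * K 0 (l ℕ.+ j))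
    ≡⟨ sum-sub {suc (suc N)} (λ l → coeff-below (E i) (toℕ l) * K 0 (toℕ l ℕ.+ j)) (λ l → E i (toℕ l) * K 0 (toℕ l ℕ.+ j)) ⟨
  ∑< (suc (suc N)) (λ l → coeff-below (E i) l * K 0 (l ℕ.+ j) - E i l * K 0 (l ℕ.+ j))
    ≡⟨ ∑<-cong (suc (suc N)) (λ l _ → trans (factor (coeff-below (E i) l) (E i l) (K 0 (l ℕ.+ j)))
         (cong (_* K 0 (l ℕ.+ j)) (sym (E-suc i l)))) ⟩
  ∑< (suc (suc N)) (λ l → E (suc i) l * K 0 (l ℕ.+ j)) ∎
  where
  factor : ∀ a b c → a * c - b * c ≡ (a - b) * c
  factor = solve-∀

-- Weights of the h-vector entries in the coefficients of g

module Weights (k : ℕ) where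

  -- The sign and truncation with which `K s`, for s of rank r, enters the coefficient of x^k in
  -- `G`.
  e : ℕ → ℤ
  e r = -1ℤ ^ r * ⟦ 2 ℕ.* k ℕ.<? r ⟧

  -- The linear functional zʳ p(y) ↦ e (r + 1) [yᵏ] (y - 1) p(y), applied to
  -- zʳ p(y) (1 + z)ᵐ (1 + z y)ʲ.

  Λ : ℕ → ℕ → ℕ → Poly → ℤ
  Λ m j r p = B m λ u → B j λ t → e (suc (r ℕ.+ u ℕ.+ t)) * D (shift t p) k

  -- Expands one factor 1 + z, where z raises `r` by one.
  Λ-sucˡ : ∀ m j r p → Λ (suc m) j r p ≡ Λ m j r p + Λ m j (suc r) p
  Λ-sucˡ m j r p = cong (_+_ (Λ m j r p)) (B-cong m λ u _ → B-cong j λ t _ →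
    cong (λ s → e (suc (s ℕ.+ t)) * D (shift t p) k) (ℕ.+-suc r u))

  -- Expands one factor 1 + z y, where y also multiplies `p`.
  Λ-sucʳ : ∀ m j r p → Λ m (suc j) r p ≡ Λ m j r p + Λ m j (suc r) (coeff-below p)
  Λ-sucʳ m j r p = trans
    (B-+ m (λ u → B j λ t → e (suc (r ℕ.+ u ℕ.+ t)) * D (shift t p) k)
           (λ u → B j λ t → e (suc (r ℕ.+ u ℕ.+ suc t)) * D (shift (suc t) p) k))
    (cong (_+_ (Λ m j r p)) (B-cong m λ u _ → B-cong j λ t _ →
      cong₂ _*_ (cong (e ∘ suc) (ℕ.+-suc (r ℕ.+ u) t)) (D-cong (λ i → sym (shift-below t p i)) k)))

  -- Writes y as 1 + (y - 1).
  Λ-below : ∀ m j r p → Λ m j r (coeff-below p) ≡ Λ m j r p + Λ m j r (D p)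
  Λ-below m j r p = trans
    (B-cong m λ u _ → trans
      (B-cong j λ t _ → trans
        (cong (e (suc (r ℕ.+ u ℕ.+ t)) *_) (trans (D-cong (split t) k) (D^-⊕ 1 (shift t p) (shift t (D p)) k)))
        (ℤ.*-distribˡ-+ (e (suc (r ℕ.+ u ℕ.+ t))) _ _))
      (B-+ j (λ t → e (suc (r ℕ.+ u ℕ.+ t)) * D (shift t p) k) (λ t → e (suc (r ℕ.+ u ℕ.+ t)) * D (shift t (D p)) k)))
    (B-+ m (λ u → B j λ t → e (suc (r ℕ.+ u ℕ.+ t)) * D (shift t p) k)
           (λ u → B j λ t → e (suc (r ℕ.+ u ℕ.+ t)) * D (shift t (D p)) k))
    where
    cancel : ∀ a b → b ≡ a + (b - a)
    cancel = solve-∀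
    split : ∀ t → shift t (coeff-below p) ≗ shift t p ⊕ shift t (D p)
    split t i = trans (shift-cong t (λ i → cancel (p i) (coeff-below p i)) i) (sym (shift-+ t p (D p) i))

  module _ (n : ℕ) where

    -- The functional applied to (z (y - 1))^i (1 + z)^(n-i-j) (1 + z y)^j.
    Δ : ℕ → ℕ → ℤ
    Δ i j = Λ (n ∸ (i ℕ.+ j)) j i (E i)

    -- This is z (y - 1) = (1 + z y) - (1 + z).
    Δ-rec : ∀ i j → i ℕ.+ j ℕ.< n → Δ (suc i) j ≡ Δ i (suc j) - Δ i j
    Δ-rec i j i+j<n = begin
      Λ M j (suc i) (D^ i (D 1ₚ))
        ≡⟨ cong (Λ M j (suc i)) (sym (D-D^ i 1ₚ)) ⟩
      Λ M j (suc i) (D (E i))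
        ≡⟨ difference (Λ M j i (E i)) (Λ M j (suc i) (E i)) _ ⟩
      Λ M j i (E i) + (Λ M j (suc i) (E i) + Λ M j (suc i) (D (E i))) - (Λ M j i (E i) + Λ M j (suc i) (E i))
        ≡⟨ cong₂ _-_ (cong (_+_ (Λ M j i (E i))) (Λ-below M j (suc i) (E i))) (Λ-sucˡ M j i (E i)) ⟨
      Λ M j i (E i) + Λ M j (suc i) (coeff-below (E i)) - Λ (suc M) j i (E i)
        ≡⟨ cong₂ _-_ (Λ-sucʳ M j i (E i)) refl ⟨
      Λ M (suc j) i (E i) - Λ (suc M) j i (E i)
        ≡⟨ cong₂ (λ a b → Λ a (suc j) i (E i) - Λ b j i (E i))
             (cong (n ∸_) (ℕ.+-suc i j)) (ℕ.+-∸-assoc 1 i+j<n) ⟨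
      Δ i (suc j) - Δ i j ∎
      where
      M = n ∸ suc (i ℕ.+ j)
      difference : ∀ a b c → c ≡ a + (b + c) - (a + b)
      difference = solve-∀

    weight : ℕ → ℤ
    weight l = Δ 0 l

    -- Expansion of ((1 + z y) - (1 + z))^i (1 + z)^(n-i) by the binomial theorem. An element of
    -- rank i + 1 contributes the left side to the coefficient of x^k in g and (x - 1)^i to the
    -- h-polynomial, so `weight l` is the factor that belongs to H_l.
    weights : ∀ i → i ℕ.≤ n → E (suc i) k * B (n ∸ i) (λ j → e (suc i ℕ.+ j)) ≡ ∑< (suc n) λ l → E i l * weight l
    weights i i≤n = begin
      E (suc i) k * B (n ∸ i) (λ j → e (suc i ℕ.+ j))
        ≡⟨ B-* (n ∸ i) (E (suc i) k) (λ j → e (suc i ℕ.+ j)) ⟨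
      B (n ∸ i) (λ j → E (suc i) k * e (suc i ℕ.+ j))
        ≡⟨ cong (λ m → B m λ j → E (suc i) k * e (suc i ℕ.+ j)) (cong (n ∸_) (sym (ℕ.+-identityʳ i))) ⟩
      B (n ∸ (i ℕ.+ 0)) (λ j → E (suc i) k * e (suc i ℕ.+ j))
        ≡⟨ B-cong (n ∸ (i ℕ.+ 0)) (λ j _ → trans (ℤ.*-comm (E (suc i) k) _)
             (cong₂ _*_ (cong (e ∘ suc) (sym (ℕ.+-identityʳ (i ℕ.+ j)))) (E-suc i k))) ⟩
      Δ i 0
        ≡⟨ newton Δ Δ-rec n i 0 i≤n (subst (ℕ._≤ n) (sym (ℕ.+-identityʳ i)) i≤n) ⟩
      ∑< (suc n) (λ l → E i l * Δ 0 (l ℕ.+ 0))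
        ≡⟨ ∑<-cong (suc n) (λ l _ → cong (λ m → E i l * Δ 0 m) (ℕ.+-identityʳ l)) ⟩
      ∑< (suc n) (λ l → E i l * weight l) ∎

  -- Consecutive ranks carry opposite signs and cancel, except when the truncation bound 2k
  -- separates them.
  e-pair : ∀ r → e r + e (suc r) ≡ - ⟦ r ℕ.≟ 2 ℕ.* k ⟧
  e-pair r with r ℕ.≟ 2 ℕ.* k
  ... | yes refl = trans
        (cong₂ (λ a b → -1ℤ ^ r * a + -1ℤ ^ suc r * b) (⟦⟧-no (r ℕ.<? r) (ℕ.<-irrefl refl)) (⟦⟧-yes (r ℕ.<? suc r) ℕ.≤-refl))
        (cong (λ s → s * 0ℤ + -1ℤ * s * 1ℤ) (-1^2j k))
  ... | no r≢2k = trans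
        (cong (λ a → e r + -1ℤ ^ suc r * a) (⟦⟧-iff (2 ℕ.* k ℕ.<? suc r) (2 ℕ.* k ℕ.<? r)
          (λ 2k<1+r → ℕ.≤∧≢⇒< (ℕ.≤-pred 2k<1+r) (r≢2k ∘ sym)) (λ 2k<r → ℕ.m≤n⇒m≤1+n 2k<r)))
        (cancel (-1ℤ ^ r) ⟦ 2 ℕ.* k ℕ.<? r ⟧)
    where
    cancel : ∀ a b → a * b + -1ℤ * a * b ≡ 0ℤ
    cancel = solve-∀

  -- Subsets are paired by one distinguished element. By `e-pair` a pair survives only if its
  -- smaller member has size 2k - c = d, and there are C(M,d) such pairs.
  B-e : ∀ M c d → c ℕ.+ d ≡ 2 ℕ.* k → B (suc M) (λ u → e (u ℕ.+ c)) ≡ - binomial M d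
  B-e M c d c+d≡2k = begin
    B M (λ u → e (u ℕ.+ c)) + B M (λ u → e (suc u ℕ.+ c))
      ≡⟨ B-+ M (λ u → e (u ℕ.+ c)) (λ u → e (suc u ℕ.+ c)) ⟨
    B M (λ u → e (u ℕ.+ c) + e (suc u ℕ.+ c))
      ≡⟨ B-cong M (λ u _ → trans (e-pair (u ℕ.+ c)) (trans
           (cong -_ (⟦⟧-iff (u ℕ.+ c ℕ.≟ 2 ℕ.* k) (u ℕ.≟ d) to from)) (neg ⟦ u ℕ.≟ d ⟧))) ⟩
    B M (λ u → ⟦ u ℕ.≟ d ⟧ * -1ℤ) ≡⟨ B-δ M d (λ _ → -1ℤ) ⟩
    binomial M d * -1ℤ ≡⟨ neg (binomial M d) ⟨
    - binomial M d ∎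
    where
    neg : ∀ a → - a ≡ a * -1ℤ
    neg = solve-∀
    to : ∀ {u} → u ℕ.+ c ≡ 2 ℕ.* k → u ≡ d
    to {u} eq = ℕ.+-cancelˡ-≡ c u d (trans (ℕ.+-comm c u) (trans eq (sym c+d≡2k)))
    from : ∀ {u} → u ≡ d → u ℕ.+ c ≡ 2 ℕ.* k
    from refl = trans (ℕ.+-comm d c) c+d≡2k

-- For k = 0 the truncation removes rank 0 only. The ranks involved are positive, so pairing along
-- one factor 1 + z, present since l < n, cancels everything.
weight-zero-< : ∀ n l → l ℕ.< n → Weights.weight 0 n l ≡ 0ℤ
weight-zero-< n l l<n = begin
  B (n ∸ l) (λ u → B l λ t → e (suc (u ℕ.+ t)) * (0ℤ - shift t 1ₚ 0))
    ≡⟨ B-cong (n ∸ l) (λ u _ → trans (B-cong l λ t _ → trans (cong (λ z → e (suc (u ℕ.+ t)) * (0ℤ - z)) (shift-1ₚ t 0))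
         (comm (e (suc (u ℕ.+ t))) ⟦ t ℕ.≟ 0 ⟧)) (trans (B-δ l 0 λ t → - e (suc (u ℕ.+ t)))
         (cong (λ v → 1ℤ * - e (suc v)) (ℕ.+-identityʳ u)))) ⟩
  B (n ∸ l) (λ u → 1ℤ * - e (suc u))
    ≡⟨ cong (λ m → B m λ u → 1ℤ * - e (suc u)) (ℕ.+-∸-assoc 1 l<n) ⟩
  B (suc M) (λ u → 1ℤ * - e (suc u))
    ≡⟨ B-+ M (λ u → 1ℤ * - e (suc u)) (λ u → 1ℤ * - e (suc (suc u))) ⟨
  B M (λ u → 1ℤ * - e (suc u) + 1ℤ * - e (suc (suc u)))
    ≡⟨ B-cong M (λ u _ → trans (collect (e (suc u)) (e (suc (suc u)))) (cong -_ (e-pair (suc u)))) ⟩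
  B M (λ _ → 0ℤ) ≡⟨ B-zero M ⟩
  0ℤ ∎
  where
  open Weights 0
  M = n ∸ suc l
  comm : ∀ a b → a * (0ℤ - b) ≡ b * - a
  comm = solve-∀
  collect : ∀ a b → 1ℤ * - a + 1ℤ * - b ≡ - (a + b)
  collect = solve-∀

-- For l = n no factor 1 + z is left, and the single surviving term t = 0 is -e(1) = 1.
weight-zero-n : ∀ n → Weights.weight 0 n n ≡ 1ℤ
weight-zero-n n = begin
  B (n ∸ n) (λ u → B n λ t → e (suc (u ℕ.+ t)) * (0ℤ - shift t 1ₚ 0))
    ≡⟨ cong (λ m → B m λ u → B n λ t → e (suc (u ℕ.+ t)) * (0ℤ - shift t 1ₚ 0)) (ℕ.n∸n≡0 n) ⟩
  B n (λ t → e (suc t) * (0ℤ - shift t 1ₚ 0))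
    ≡⟨ B-cong n (λ t _ → trans (cong (λ z → e (suc t) * (0ℤ - z)) (shift-1ₚ t 0)) (comm (e (suc t)) ⟦ t ℕ.≟ 0 ⟧)) ⟩
  B n (λ t → ⟦ t ℕ.≟ 0 ⟧ * - e (suc t)) ≡⟨ B-δ n 0 (λ t → - e (suc t)) ⟩
  1ℤ ∎
  where
  open Weights 0
  comm : ∀ a b → a * (0ℤ - b) ≡ b * - a
  comm = solve-∀

module _ (k : ℕ) where
  open Weights (suc k)

  private
    -- The coefficient of y^(k+1) in (y - 1) y^t is nonzero only for t = k and t = k + 1. The module
    -- parameter is one less than the degree under study.
    weight-expand : ∀ n l → weight n l ≡ B (n ∸ l) λ u →
                    binomial l k * e (u ℕ.+ suc k) - binomial l (suc k) * e (u ℕ.+ suc (suc k))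
    weight-expand n l = B-cong (n ∸ l) λ u _ → begin
      B l (λ t → e (suc (u ℕ.+ t)) * (shift t 1ₚ k - shift t 1ₚ (suc k)))
        ≡⟨ B-cong l (λ t _ → trans (cong₂ (λ a b → e (suc (u ℕ.+ t)) * (a - b)) (shift-1ₚ t k) (shift-1ₚ t (suc k)))
             (distrib (e (suc (u ℕ.+ t))) ⟦ t ℕ.≟ k ⟧ ⟦ t ℕ.≟ suc k ⟧)) ⟩
      B l (λ t → ⟦ t ℕ.≟ k ⟧ * e (suc (u ℕ.+ t)) + ⟦ t ℕ.≟ suc k ⟧ * - e (suc (u ℕ.+ t)))
        ≡⟨ B-+ l (λ t → ⟦ t ℕ.≟ k ⟧ * e (suc (u ℕ.+ t))) (λ t → ⟦ t ℕ.≟ suc k ⟧ * - e (suc (u ℕ.+ t))) ⟩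
      B l (λ t → ⟦ t ℕ.≟ k ⟧ * e (suc (u ℕ.+ t))) + B l (λ t → ⟦ t ℕ.≟ suc k ⟧ * - e (suc (u ℕ.+ t)))
        ≡⟨ cong₂ _+_ (B-δ l k λ t → e (suc (u ℕ.+ t))) (B-δ l (suc k) λ t → - e (suc (u ℕ.+ t))) ⟩
      binomial l k * e (suc (u ℕ.+ k)) + binomial l (suc k) * - e (suc (u ℕ.+ suc k))
        ≡⟨ cong₂ _+_ (cong (λ v → binomial l k * e v) (sym (ℕ.+-suc u k)))
             (trans (sym (ℤ.neg-distribʳ-* (binomial l (suc k)) _)) (cong (λ v → - (binomial l (suc k) * e v)) (sym (ℕ.+-suc u (suc k))))) ⟩
      binomial l k * e (u ℕ.+ suc k) - binomial l (suc k) * e (u ℕ.+ suc (suc k)) ∎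
      where
      distrib : ∀ a b c → a * (b - c) ≡ b * a + c * - a
      distrib = solve-∀

  -- With n + 1 in place of n a factor 1 + z remains, so `B-e` applies. The offsets k + 1 and k + 2
  -- leave k + 1 and k up to the bound 2 (k + 1), whence the lower entries of the binomials.
  weight-suc-< : ∀ n l → l ℕ.≤ n → weight (suc n) l ≡
    binomial l (suc k) * binomial (n ∸ l) k - binomial l k * binomial (n ∸ l) (suc k)
  weight-suc-< n l l≤n = begin
    weight (suc n) l ≡⟨ weight-expand (suc n) l ⟩
    B (suc n ∸ l) (λ u → b₁ * e (u ℕ.+ suc k) - b₂ * e (u ℕ.+ suc (suc k)))
      ≡⟨ cong (λ m → B m λ u → b₁ * e (u ℕ.+ suc k) - b₂ * e (u ℕ.+ suc (suc k))) (ℕ.+-∸-assoc 1 l≤n) ⟩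
    B (suc M) (λ u → b₁ * e (u ℕ.+ suc k) - b₂ * e (u ℕ.+ suc (suc k)))
      ≡⟨ B-cong (suc M) (λ u _ → cong (_+_ (b₁ * e (u ℕ.+ suc k))) (ℤ.neg-distribˡ-* b₂ _)) ⟩
    B (suc M) (λ u → b₁ * e (u ℕ.+ suc k) + - b₂ * e (u ℕ.+ suc (suc k)))
      ≡⟨ B-+ (suc M) (λ u → b₁ * e (u ℕ.+ suc k)) (λ u → - b₂ * e (u ℕ.+ suc (suc k))) ⟩
    B (suc M) (λ u → b₁ * e (u ℕ.+ suc k)) + B (suc M) (λ u → - b₂ * e (u ℕ.+ suc (suc k)))
      ≡⟨ cong₂ _+_ (B-* (suc M) b₁ λ u → e (u ℕ.+ suc k)) (B-* (suc M) (- b₂) λ u → e (u ℕ.+ suc (suc k))) ⟩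
    b₁ * B (suc M) (λ u → e (u ℕ.+ suc k)) + - b₂ * B (suc M) (λ u → e (u ℕ.+ suc (suc k)))
      ≡⟨ cong₂ (λ x y → b₁ * x + - b₂ * y)
           (B-e M (suc k) (suc k) (cong (λ z → suc k ℕ.+ z) (sym (ℕ.+-identityʳ (suc k)))))
           (B-e M (suc (suc k)) k (trans (sym (ℕ.+-suc (suc k) k)) (cong (λ z → suc k ℕ.+ z) (sym (ℕ.+-identityʳ (suc k)))))) ⟩
    b₁ * - binomial M (suc k) + - b₂ * - binomial M k
      ≡⟨ signs b₁ b₂ (binomial M (suc k)) (binomial M k) ⟩
    b₂ * binomial M k - b₁ * binomial M (suc k) ∎
    where
    M = n ∸ l
    b₁ = binomial l k
    b₂ = binomial l (suc k)
    signs : ∀ a b c d → a * - c + - b * - d ≡ b * d - a * c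
    signs = solve-∀

  -- Only the ranks k + 1 and k + 2 occur; both are at most 2 (k + 1), so the truncation removes
  -- them.
  weight-suc-n : ∀ n → weight n n ≡ 0ℤ
  weight-suc-n n = begin
    weight n n ≡⟨ weight-expand n n ⟩
    B (n ∸ n) (λ u → binomial n k * e (u ℕ.+ suc k) - binomial n (suc k) * e (u ℕ.+ suc (suc k)))
      ≡⟨ cong (λ m → B m λ u → binomial n k * e (u ℕ.+ suc k) - binomial n (suc k) * e (u ℕ.+ suc (suc k))) (ℕ.n∸n≡0 n) ⟩
    binomial n k * e (suc k) - binomial n (suc k) * e (suc (suc k))
      ≡⟨ cong₂ (λ x y → binomial n k * x - binomial n (suc k) * y) (e≡0 (suc k) (ℕ.m≤m+n (suc k) _))
           (e≡0 (suc (suc k)) (ℕ.≤-trans (ℕ.≤-reflexive (ℕ.+-comm 1 (suc k))) (ℕ.+-monoʳ-≤ (suc k) (ℕ.s≤s ℕ.z≤n)))) ⟩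
    binomial n k * 0ℤ - binomial n (suc k) * 0ℤ
      ≡⟨ cong₂ _-_ (ℤ.*-zeroʳ (binomial n k)) (ℤ.*-zeroʳ (binomial n (suc k))) ⟩
    0ℤ ∎
    where
    e≡0 : ∀ r → r ℕ.≤ 2 ℕ.* suc k → e r ≡ 0ℤ
    e≡0 r r≤ = trans (cong (-1ℤ ^ r *_) (⟦⟧-no (2 ℕ.* suc k ℕ.<? r) (ℕ.≤⇒≯ r≤))) (ℤ.*-zeroʳ (-1ℤ ^ r))

-- Coefficients of g in terms of the toric h-vector

module Combination (P : GradedPoset) (n : ℕ) (rank≡ : GradedPoset.rank P ≡ suc n)
  (eulerian : Eulerian P) (dualSimplicial : DualSimplicial P) where

  open GradedPoset P
  open Sums P
  open DualSimplicialEulerian P eulerian dualSimplicial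

  1̂≢0̂ : 1̂ ≢ 0̂
  1̂≢0̂ 1̂≡0̂ = ℕ.0≢1+n (trans (sym ρ-0̂) (trans (cong ρ (sym 1̂≡0̂)) rank≡))

  ρ≤1+n : ∀ q → ρ q ℕ.≤ suc n
  ρ≤1+n q = subst (ρ q ℕ.≤_) rank≡ (ρ≤rank q)

  ρ∸1≤n : ∀ q → ρ q ∸ 1 ℕ.≤ n
  ρ∸1≤n q = ℕ.∸-monoˡ-≤ 1 (ρ≤1+n q)

  1+[ρ∸1] : ∀ {q} → q ≢ 0̂ → suc (ρ q ∸ 1) ≡ ρ q
  1+[ρ∸1] q≢0̂ with ρ-suc q≢0̂
  ... | d , ρq≡ rewrite ρq≡ = refl

  ζ-1̂ : ∀ q → ζ q 1̂ ≡ 1ℤ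
  ζ-1̂ q = ⟦⟧-yes (q ≤? 1̂) (1̂-maximum q)

  open Toric.Characterization P (λ _ → ⊤) (λ _ _ → tt) G G-0̂ (λ p _ → G-high p) (λ p _ → G-low p)
    using () renaming (-D-toricF≡G to -D-toricF)

  -D-toricF-1̂ : ∀ k → 2 ℕ.* k ℕ.≤ n → - D (toricF P 1̂) k ≡ G 1̂ k
  -D-toricF-1̂ k 2k≤n = -D-toricF tt 1̂≢0̂ k (subst (2 ℕ.* k ℕ.<_) (sym rank≡) (ℕ.s≤s 2k≤n))

  -- The h-polynomial of the dual of P, before it is reversed by toricH.

  H : Poly
  H k = ∑ₓ λ q → nz q * E (ρ q ∸ 1) k

  -- After exchanging the sums over q ≤ s, the elements s of the Boolean interval [q,1̂] are counted
  -- by rank. This gives the left side of `weights` for rank ρ(q), and summing the expansions over q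
  -- collects the coefficients of H.
  G-1̂ : ∀ k → G 1̂ k ≡ ∑< (suc n) λ l → H l * Weights.weight k n l
  G-1̂ k = begin
    G 1̂ k ≡⟨ cong (_+ ∑ₓ λ s → (nz s * ζ s 1̂) * γ s k) (cong (_* 1ₚ k) (⟦⟧-no (1̂ ≟ 0̂) 1̂≢0̂)) ⟩
    0ℤ + ∑ₓ (λ s → (nz s * ζ s 1̂) * γ s k) ≡⟨ ℤ.+-identityˡ _ ⟩
    ∑ₓ (λ s → (nz s * ζ s 1̂) * γ s k)
      ≡⟨ ∑ₓ-cong (λ s → trans (cong (λ z → (nz s * z) * γ s k) (ζ-1̂ s))
           (regroup (nz s) (-1ℤ ^ ρ s) ⟦ 2 ℕ.* k ℕ.<? ρ s ⟧ (K s k))) ⟩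
    ∑ₓ (λ s → (nz s * e (ρ s)) * ∑ₓ λ q → (nz q * ζ q s) * E (ρ q) k)
      ≡⟨ ∑ₓ-swap (λ s → nz s * e (ρ s)) (λ s q → (nz q * ζ q s) * E (ρ q) k) ⟩
    ∑ₓ (λ q → ∑ₓ λ s → (nz s * e (ρ s)) * ((nz q * ζ q s) * E (ρ q) k))
      ≡⟨ ∑ₓ-cong inner ⟩
    ∑ₓ (λ q → nz q * ∑< (suc n) λ l → E (ρ q ∸ 1) l * weight n l)
      ≡⟨ sum-swap {n = suc n} (λ i → nz (element i)) (λ i l → E (ρ (element i) ∸ 1) (toℕ l) * weight n (toℕ l)) ⟩
    ∑< (suc n) (λ l → ∑ₓ λ q → nz q * (E (ρ q ∸ 1) l * weight n l))
      ≡⟨ ∑<-cong (suc n) (λ l _ → trans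
           (∑ₓ-cong λ q → sym (ℤ.*-assoc (nz q) (E (ρ q ∸ 1) l) (weight n l)))
           (sum-*ʳ (λ i → nz (element i) * E (ρ (element i) ∸ 1) l) (weight n l))) ⟩
    ∑< (suc n) (λ l → H l * weight n l) ∎
    where
    open Weights k
    regroup : ∀ a b c d → (a * 1ℤ) * (b * (c * d)) ≡ (a * (b * c)) * d
    regroup = solve-∀
    rearrange : ∀ a b c d f → (a * b) * ((c * d) * f) ≡ f * (a * (c * (d * (1ℤ * b))))
    rearrange = solve-∀
    comm : ∀ a b c → a * (b * c) ≡ b * (a * c)
    comm = solve-∀
    inner : ∀ q → ∑ₓ (λ s → (nz s * e (ρ s)) * ((nz q * ζ q s) * E (ρ q) k))
                  ≡ nz q * ∑< (suc n) λ l → E (ρ q ∸ 1) l * weight n l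
    inner q = begin
      ∑ₓ (λ s → (nz s * e (ρ s)) * ((nz q * ζ q s) * E (ρ q) k))
        ≡⟨ ∑ₓ-cong (λ s → trans (rearrange (nz s) (e (ρ s)) (nz q) (ζ q s) (E (ρ q) k))
             (cong (E (ρ q) k *_) (trans (cong (λ z → nz s * (nz q * (ζ q s * (z * e (ρ s))))) (sym (ζ-1̂ s)))
               (nz-absorb q s (ζ s 1̂ * e (ρ s)))))) ⟩
      ∑ₓ (λ s → E (ρ q) k * (nz q * (ζ q s * (ζ s 1̂ * e (ρ s)))))
        ≡⟨ ∑ₓ-cong (λ s → comm (E (ρ q) k) (nz q) (ζ q s * (ζ s 1̂ * e (ρ s)))) ⟩
      ∑ₓ (λ s → nz q * (E (ρ q) k * (ζ q s * (ζ s 1̂ * e (ρ s)))))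
        ≡⟨ trans (∑ₓ-* (nz q) (λ s → E (ρ q) k * (ζ q s * (ζ s 1̂ * e (ρ s)))))
             (cong (nz q *_) (∑ₓ-* (E (ρ q) k) (λ s → ζ q s * (ζ s 1̂ * e (ρ s))))) ⟩
      nz q * (E (ρ q) k * ∑ₓ (λ s → ζ q s * (ζ s 1̂ * e (ρ s))))
        ≡⟨ nz-* q count ⟩
      nz q * ∑< (suc n) (λ l → E (ρ q ∸ 1) l * weight n l) ∎
      where
      count : q ≢ 0̂ → E (ρ q) k * ∑ₓ (λ s → ζ q s * (ζ s 1̂ * e (ρ s))) ≡ ∑< (suc n) λ l → E (ρ q ∸ 1) l * weight n l
      count q≢0̂ = begin
        E (ρ q) k * ∑ₓ (λ s → ζ q s * (ζ s 1̂ * e (ρ s)))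
          ≡⟨ cong (E (ρ q) k *_) (trans (∑-interval q≢0̂ 1̂ e)
               (trans (cong (_* B (rank ∸ ρ q) (λ j → e (ρ q ℕ.+ j))) (ζ-1̂ q)) (ℤ.*-identityˡ _))) ⟩
        E (ρ q) k * B (rank ∸ ρ q) (λ j → e (ρ q ℕ.+ j))
          ≡⟨ cong (λ r → E (ρ q) k * B (r ∸ ρ q) (λ j → e (ρ q ℕ.+ j))) rank≡ ⟩
        E (ρ q) k * B (suc n ∸ ρ q) (λ j → e (ρ q ℕ.+ j))
          ≡⟨ cong (λ r → E r k * B (suc n ∸ r) (λ j → e (r ℕ.+ j))) (1+[ρ∸1] q≢0̂) ⟨
        E (suc (ρ q ∸ 1)) k * B (n ∸ (ρ q ∸ 1)) (λ j → e (suc (ρ q ∸ 1) ℕ.+ j))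
          ≡⟨ weights n (ρ q ∸ 1) (ρ∸1≤n q) ⟩
        ∑< (suc n) (λ l → E (ρ q ∸ 1) l * weight n l) ∎

  -- The Dehn–Sommerville equations.

  H-symmetric : ∀ {a b} → a ℕ.+ b ≡ n → H a ≡ H b
  H-symmetric {a} {b} a+b≡n = begin
    ∑ₓ (λ q → nz q * E (ρ q ∸ 1) a)
      ≡⟨ ∑ₓ-cong (λ q → trans (nz-* q (expand q)) (sym (ℤ.*-assoc (nz q) (sg (ρ q ∸ 1)) _))) ⟩
    ∑ₓ (λ q → (nz q * sg (ρ q ∸ 1)) * ∑ₓ λ r → ζ q r * (ζ r 1̂ * D^ (ρ r ∸ ρ q) (E (ρ q ∸ 1)) b))
      ≡⟨ ∑ₓ-swap (λ q → nz q * sg (ρ q ∸ 1)) (λ q r → ζ q r * (ζ r 1̂ * D^ (ρ r ∸ ρ q) (E (ρ q ∸ 1)) b)) ⟩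
    ∑ₓ (λ r → ∑ₓ λ q → (nz q * sg (ρ q ∸ 1)) * (ζ q r * (ζ r 1̂ * D^ (ρ r ∸ ρ q) (E (ρ q ∸ 1)) b)))
      ≡⟨ ∑ₓ-cong (λ r → trans (∑ₓ-cong λ q → term q r)
           (sum-*ʳ (λ i → nz (element i) * (ζ (element i) r * sg (ρ (element i)))) (- E (ρ r ∸ 1) b))) ⟩
    ∑ₓ (λ r → ∑ₓ (λ q → nz q * (ζ q r * sg (ρ q))) * - E (ρ r ∸ 1) b)
      ≡⟨ ∑ₓ-cong (λ r → trans (cong (_* - E (ρ r ∸ 1) b) (euler-nz r (r ≟ 0̂))) (neg*neg (nz r) (E (ρ r ∸ 1) b))) ⟩
    ∑ₓ (λ r → nz r * E (ρ r ∸ 1) b) ∎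
    where
    neg*neg : ∀ a b → - a * - b ≡ a * b
    neg*neg = solve-∀
    euler-nz : ∀ r → Dec (r ≡ 0̂) → ∑ₓ (λ q → nz q * (ζ q r * sg (ρ q))) ≡ - nz r
    euler-nz r (no r≢0̂) = trans (euler r≢0̂) (cong -_ (sym (nz≡1 r≢0̂)))
    euler-nz r (yes refl) = trans
      (sum-zero λ i → ⟦⟧-*-zero (¬? (element i ≟ 0̂)) λ q≢0̂ → ⟦⟧-*-zero (element i ≤? 0̂) λ q≤0̂ →
        contradiction refl (above≢0̂ q≢0̂ q≤0̂))
      (cong -_ (sym (⟦⟧-no (¬? (0̂ ≟ 0̂)) (_$ refl))))
    -- Reversal in degree n turns (x - 1)^(ρ(q)-1) into itself times a sign and x^(n+1-ρ(q)). That
    -- power of x is the sum of (x - 1)^(ρ(r)-ρ(q)) over r ≥ q; the product (x - 1)^(ρ(r)-1) depends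
    -- on r alone, and the signs over q ≤ r form an Euler sum.
    expand : ∀ q → q ≢ 0̂ → E (ρ q ∸ 1) a ≡ sg (ρ q ∸ 1) * ∑ₓ λ r → ζ q r * (ζ r 1̂ * D^ (ρ r ∸ ρ q) (E (ρ q ∸ 1)) b)
    expand q q≢0̂ = begin
      E (ρ q ∸ 1) a
        ≡⟨ E-reverse-shift (rank ∸ ρ q) (ρ q ∸ 1) {a} {b} degrees ⟩
      sg (ρ q ∸ 1) * shift (rank ∸ ρ q) (E (ρ q ∸ 1)) b
        ≡⟨ cong (sg (ρ q ∸ 1) *_) (trans (∑-interval-D^ q≢0̂ 1̂ (E (ρ q ∸ 1)) b)
             (trans (cong (_* shift (rank ∸ ρ q) (E (ρ q ∸ 1)) b) (ζ-1̂ q)) (ℤ.*-identityˡ _))) ⟨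
      sg (ρ q ∸ 1) * ∑ₓ (λ r → ζ q r * (ζ r 1̂ * D^ (ρ r ∸ ρ q) (E (ρ q ∸ 1)) b)) ∎
      where
      degrees : a ℕ.+ b ≡ (rank ∸ ρ q) ℕ.+ (ρ q ∸ 1)
      degrees = begin
        a ℕ.+ b ≡⟨ a+b≡n ⟩
        n ≡⟨ ℕ.m∸n+n≡m (ρ∸1≤n q) ⟨
        (suc n ∸ suc (ρ q ∸ 1)) ℕ.+ (ρ q ∸ 1)
          ≡⟨ cong₂ (λ x y → (x ∸ y) ℕ.+ (ρ q ∸ 1)) (sym rank≡) (1+[ρ∸1] q≢0̂) ⟩
        (rank ∸ ρ q) ℕ.+ (ρ q ∸ 1) ∎
    regroup : ∀ a b c d → (a * b) * (c * (1ℤ * d)) ≡ a * (c * (b * d))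
    regroup = solve-∀
    regroup′ : ∀ a b c d → a * (c * (b * d)) ≡ (a * (c * (-1ℤ * b))) * - d
    regroup′ = solve-∀
    term : ∀ q r → (nz q * sg (ρ q ∸ 1)) * (ζ q r * (ζ r 1̂ * D^ (ρ r ∸ ρ q) (E (ρ q ∸ 1)) b))
                   ≡ (nz q * (ζ q r * sg (ρ q))) * - E (ρ r ∸ 1) b
    term q r = begin
      (nz q * sg (ρ q ∸ 1)) * (ζ q r * (ζ r 1̂ * x))
        ≡⟨ cong (λ z → (nz q * sg (ρ q ∸ 1)) * (ζ q r * (z * x))) (ζ-1̂ r) ⟩
      (nz q * sg (ρ q ∸ 1)) * (ζ q r * (1ℤ * x)) ≡⟨ regroup (nz q) (sg (ρ q ∸ 1)) (ζ q r) x ⟩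
      nz q * (ζ q r * (sg (ρ q ∸ 1) * x))
        ≡⟨ nz-* q (λ q≢0̂ → ⟦⟧-*-cong (q ≤? r) λ q≤r → cong (λ p → sg (ρ q ∸ 1) * p b) (merge q≢0̂ q≤r)) ⟩
      nz q * (ζ q r * (sg (ρ q ∸ 1) * E (ρ r ∸ 1) b)) ≡⟨ regroup′ (nz q) (sg (ρ q ∸ 1)) (ζ q r) (E (ρ r ∸ 1) b) ⟩
      (nz q * (ζ q r * sg (suc (ρ q ∸ 1)))) * - E (ρ r ∸ 1) b
        ≡⟨ cong (_* - E (ρ r ∸ 1) b) (nz-* q λ q≢0̂ → cong (λ i → ζ q r * sg i) (1+[ρ∸1] q≢0̂)) ⟩
      (nz q * (ζ q r * sg (ρ q))) * - E (ρ r ∸ 1) b ∎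
      where
      x = D^ (ρ r ∸ ρ q) (E (ρ q ∸ 1)) b
      merge : q ≢ 0̂ → q ≤ r → D^ (ρ r ∸ ρ q) (E (ρ q ∸ 1)) ≡ E (ρ r ∸ 1)
      merge q≢0̂ q≤r = trans (D^-+ (ρ q ∸ 1) (ρ r ∸ ρ q) 1ₚ) (cong E (begin
        (ρ q ∸ 1) ℕ.+ (ρ r ∸ ρ q)         ≡⟨ ℕ.+-comm (ρ q ∸ 1) (ρ r ∸ ρ q) ⟩
        (ρ r ∸ ρ q) ℕ.+ (ρ q ∸ 1)         ≡⟨ ℕ.+-∸-assoc (ρ r ∸ ρ q) (subst (1 ℕ.≤_) (1+[ρ∸1] q≢0̂) (ℕ.s≤s ℕ.z≤n)) ⟨
        (ρ r ∸ ρ q) ℕ.+ ρ q ∸ 1           ≡⟨ cong (_∸ 1) (ℕ.m∸n+n≡m (ρ-mono-≤ q≤r)) ⟩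
        ρ r ∸ 1 ∎))

  h : ℕ → ℤ
  h = toricH (dual P)

  -- In the dual poset every lower interval except the whole poset is Boolean, so all g in Stanley's
  -- formula for f are 1 and f is H. The reversal in `toricH` changes the index to n - i.
  h≡H-reversed : ∀ i → i ℕ.≤ n → h i ≡ H (n ∸ i)
  h≡H-reversed i i≤n = begin
    reverse (rank ∸ ρ 0̂ ∸ 1) f i
      ≡⟨ cong (λ r → reverse (r ∸ 1) f i) ρ-dual ⟩
    reverse n f i
      ≡⟨ cong (reverse n f) (ℕ.m∸[m∸n]≡n i≤n) ⟨
    reverse n f (n ∸ (n ∸ i))
      ≡⟨ reverse-coeff n f (n ∸ i) (ℕ.m∸n≤m n i) ⟩
    f (n ∸ i)
      ≡⟨ toricF-∑ {0̂} {n} ρ-dual (n ∸ i) ⟩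
    ∑ₓ (λ q → ⟦ GradedPoset._<?_ (dual P) q 0̂ ⟧ * D^ (n ∸ (rank ∸ ρ q)) (toricG (dual P) q) (n ∸ i))
      ≡⟨ ∑ₓ-cong (λ q → trans
           (cong (_* D^ (n ∸ (rank ∸ ρ q)) (toricG (dual P) q) (n ∸ i))
             (⟦⟧-iff (GradedPoset._<?_ (dual P) q 0̂) (¬? (q ≟ 0̂)) proj₂ (λ q≢0̂ → 0̂-minimum q , q≢0̂)))
           (nz-* q λ q≢0̂ → trans (D^-cong (n ∸ (rank ∸ ρ q)) (toricG≗G q q≢0̂) (n ∸ i))
             (cong (λ d → E d (n ∸ i)) (exponent q≢0̂)))) ⟩
    H (n ∸ i) ∎
    where
    open Toric (dual P) using (toricF-∑; module LowerBoolean)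
    f = toricF (dual P) 0̂
    ρ-dual : rank ∸ ρ 0̂ ≡ suc n
    ρ-dual = trans (cong (rank ∸_) ρ-0̂) rank≡
    down : ∀ {q p} → p ≤ q × q ≢ p → p ≢ 0̂ → q ≢ 0̂
    down (p≤q , _) p≢0̂ = above≢0̂ p≢0̂ p≤q
    count : ∀ p → p ≢ 0̂ → ∀ F → ∑ₓ (λ q → ζ p q * F (rank ∸ ρ q)) ≡ B (rank ∸ ρ p) F
    count p p≢0̂ F = begin
      ∑ₓ (λ q → ζ p q * F (rank ∸ ρ q))
        ≡⟨ ∑ₓ-cong (λ q → cong (ζ p q *_) (sym (trans (cong (_* F (rank ∸ ρ q)) (ζ-1̂ q)) (ℤ.*-identityˡ _)))) ⟩
      ∑ₓ (λ q → ζ p q * (ζ q 1̂ * F (rank ∸ ρ q)))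
        ≡⟨ ∑-interval p≢0̂ 1̂ (λ r → F (rank ∸ r)) ⟩
      ζ p 1̂ * B (rank ∸ ρ p) (λ j → F (rank ∸ (ρ p ℕ.+ j)))
        ≡⟨ trans (cong (_* B (rank ∸ ρ p) (λ j → F (rank ∸ (ρ p ℕ.+ j)))) (ζ-1̂ p)) (ℤ.*-identityˡ _) ⟩
      B (rank ∸ ρ p) (λ j → F (rank ∸ (ρ p ℕ.+ j)))
        ≡⟨ B-cong (rank ∸ ρ p) (λ j _ → cong F (sym (ℕ.∸-+-assoc rank (ρ p) j))) ⟩
      B (rank ∸ ρ p) (λ j → F (rank ∸ ρ p ∸ j))
        ≡⟨ B-reverse (rank ∸ ρ p) F ⟩
      B (rank ∸ ρ p) F ∎
    open LowerBoolean (_≢ 0̂) down count using (toricG≗G)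
    exponent : ∀ {q} → q ≢ 0̂ → n ∸ (rank ∸ ρ q) ≡ ρ q ∸ 1
    exponent {q} q≢0̂ = begin
      n ∸ (rank ∸ ρ q) ≡⟨ cong₂ (λ a b → n ∸ (a ∸ b)) (sym (sym rank≡)) (sym (1+[ρ∸1] q≢0̂)) ⟩
      n ∸ (n ∸ (ρ q ∸ 1)) ≡⟨ ℕ.m∸[m∸n]≡n (ρ∸1≤n q) ⟩
      ρ q ∸ 1 ∎

  h≡H : ∀ i → i ℕ.≤ n → h i ≡ H i
  h≡H i i≤n = trans (h≡H-reversed i i≤n) (H-symmetric (ℕ.m∸n+n≡m i≤n))

  -- Among the weights for k = 0 only that of H_n is nonzero, and H_n is h_0.
  G-1̂-zero : G 1̂ 0 ≡ h 0
  G-1̂-zero = begin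
    G 1̂ 0 ≡⟨ G-1̂ 0 ⟩
    ∑< (suc n) (λ l → H l * Weights.weight 0 n l) ≡⟨ ∑<-last n (λ l → H l * Weights.weight 0 n l) ⟩
    ∑< n (λ l → H l * Weights.weight 0 n l) + H n * Weights.weight 0 n n
      ≡⟨ cong₂ _+_ (∑<-zero n λ l l<n → trans (cong (H l *_) (weight-zero-< n l l<n)) (ℤ.*-zeroʳ (H l)))
                   (trans (cong (H n *_) (weight-zero-n n)) (ℤ.*-identityʳ (H n))) ⟩
    0ℤ + H n ≡⟨ ℤ.+-identityˡ (H n) ⟩
    H n ≡⟨ h≡H-reversed 0 ℕ.z≤n ⟨
    h 0 ∎

-- The short toric polynomial

coefficient : ℕ → ℕ → ℕ → ℤ
coefficient n i k =
  + ((n ∸ i) C k) * + ((i ∸ 1) C (k ∸ 1)) - + ((n ∸ i ∸ 1) C k) * + (i C (k ∸ 1))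

module _ (P : GradedPoset) (n : ℕ) (rank≡ : GradedPoset.rank P ≡ suc (suc n))
  (eulerian : Eulerian P) (dualSimplicial : DualSimplicial P) where

  open DualSimplicialEulerian P eulerian dualSimplicial using (G)
  open Combination P (suc n) rank≡ eulerian dualSimplicial
  open GradedPoset P using (1̂)

  -- The first product of each weight is reindexed by H_(n-i) = h_(i+1), the second by H_l = h_l. At
  -- l = 0 the first vanishes, and the second leaves n h_0 for k = 0 only; this is the source of the
  -- exceptional term of the theorem, whose n is one larger than the n used here.
  G-1̂-suc : ∀ k → G 1̂ (suc k) ≡
            ∑< n (λ i → h (suc i) * coefficient (suc n) (suc i) (suc k)) - h 0 * (+ n * ⟦ k ℕ.≟ 0 ⟧)
  G-1̂-suc k = begin
    G 1̂ (suc k) ≡⟨ G-1̂ (suc k) ⟩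
    ∑< (suc (suc n)) (λ l → H l * weight (suc n) l)
      ≡⟨ ∑<-last (suc n) (λ l → H l * weight (suc n) l) ⟩
    ∑< (suc n) (λ l → H l * weight (suc n) l) + H (suc n) * weight (suc n) (suc n)
      ≡⟨ cong₂ _+_ (∑<-cong (suc n) λ l l<1+n → trans (cong (H l *_) (weight-suc-< k n l (ℕ.≤-pred l<1+n))) (distrib (H l) (binomial l (suc k) * binomial (n ∸ l) k) (binomial l k * binomial (n ∸ l) (suc k))))
                   (trans (cong (H (suc n) *_) (weight-suc-n k (suc n))) (ℤ.*-zeroʳ (H (suc n)))) ⟩
    ∑< (suc n) (λ l → Φ l - Ψ l) + 0ℤ
      ≡⟨ trans (ℤ.+-identityʳ _) (sum-sub {suc n} (Φ ∘ toℕ) (Ψ ∘ toℕ)) ⟩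
    ∑< (suc n) Φ - ∑< (suc n) Ψ
      ≡⟨ cong₂ _-_ Φ-sum (cong₂ _+_ Ψ-first (∑<-cong n Ψ-rest)) ⟩
    ∑< n (λ i → h (suc i) * x i) - (h 0 * (+ n * ⟦ k ℕ.≟ 0 ⟧) + ∑< n (λ i → h (suc i) * y i))
      ≡⟨ regroup (∑< n (λ i → h (suc i) * x i)) _ _ ⟩
    ∑< n (λ i → h (suc i) * x i) - ∑< n (λ i → h (suc i) * y i) - h 0 * (+ n * ⟦ k ℕ.≟ 0 ⟧)
      ≡⟨ cong (_- h 0 * (+ n * ⟦ k ℕ.≟ 0 ⟧)) (trans
           (sym (sum-sub {n} (λ i → h (suc (toℕ i)) * x (toℕ i)) (λ i → h (suc (toℕ i)) * y (toℕ i))))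
           (∑<-cong n λ i _ → factor (h (suc i)) (x i) (y i))) ⟩
    ∑< n (λ i → h (suc i) * coefficient (suc n) (suc i) (suc k)) - h 0 * (+ n * ⟦ k ℕ.≟ 0 ⟧) ∎
    where
    open Weights (suc k)
    distrib : ∀ a b c → a * (b - c) ≡ a * b - a * c
    distrib = solve-∀
    factor : ∀ a b c → a * b - a * c ≡ a * (b - c)
    factor = solve-∀
    regroup : ∀ a b c → a - (b + c) ≡ a - c - b
    regroup = solve-∀
    Φ Ψ x y : ℕ → ℤ
    Φ l = H l * (binomial l (suc k) * binomial (n ∸ l) k)
    Ψ l = H l * (binomial l k * binomial (n ∸ l) (suc k))
    x i = binomial (n ∸ i) (suc k) * binomial i k
    y i = binomial (n ∸ i ∸ 1) (suc k) * binomial (suc i) k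
    binomial-0-suc : ∀ j → binomial 0 (suc j) ≡ 0ℤ
    binomial-0-suc j = cong +_ (k>n⇒nCk≡0 (ℕ.s≤s (ℕ.z≤n {j})))
    Φ-0 : Φ (n ∸ n) ≡ 0ℤ
    Φ-0 = trans (cong Φ (ℕ.n∸n≡0 n)) (trans (cong (λ z → H 0 * (z * binomial n k)) (binomial-0-suc k)) (ℤ.*-zeroʳ (H 0)))
    Φ-sum : ∑< (suc n) Φ ≡ ∑< n λ i → h (suc i) * x i
    Φ-sum = begin
      ∑< (suc n) Φ                    ≡⟨ ∑<-reverse n Φ ⟨
      ∑< (suc n) (λ i → Φ (n ∸ i))    ≡⟨ ∑<-last n (λ i → Φ (n ∸ i)) ⟩
      ∑< n (λ i → Φ (n ∸ i)) + Φ (n ∸ n)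
        ≡⟨ cong₂ _+_ (∑<-cong n λ i i<n → cong₂ (λ a j → a * (binomial (n ∸ i) (suc k) * binomial j k))
             (sym (h≡H-reversed (suc i) (ℕ.m≤n⇒m≤1+n i<n))) (ℕ.m∸[m∸n]≡n (ℕ.<⇒≤ i<n))) Φ-0 ⟩
      ∑< n (λ i → h (suc i) * x i) + 0ℤ ≡⟨ ℤ.+-identityʳ _ ⟩
      ∑< n (λ i → h (suc i) * x i) ∎
    0Ck : ∀ k → binomial 0 k * binomial n (suc k) ≡ + n * ⟦ k ℕ.≟ 0 ⟧
    0Ck zero    = trans (ℤ.*-identityˡ _) (trans (cong +_ (nC1≡n n)) (sym (ℤ.*-identityʳ (+ n))))
    0Ck (suc k) = trans (cong (_* binomial n (suc (suc k))) (binomial-0-suc k)) (sym (ℤ.*-zeroʳ (+ n)))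
    Ψ-first : Ψ 0 ≡ h 0 * (+ n * ⟦ k ℕ.≟ 0 ⟧)
    Ψ-first = cong₂ _*_ (sym (h≡H 0 ℕ.z≤n)) (0Ck k)
    Ψ-rest : ∀ i → i ℕ.< n → Ψ (suc i) ≡ h (suc i) * y i
    Ψ-rest i i<n = cong₂ _*_ (sym (h≡H (suc i) (ℕ.m≤n⇒m≤1+n i<n)))
      (trans (ℤ.*-comm (binomial (suc i) k) _) (cong (λ j → binomial j (suc k) * binomial (suc i) k)
        (trans (cong (n ∸_) (ℕ.+-comm 1 i)) (sym (ℕ.∸-+-assoc n i 1)))))

short-cong : ∀ n {f f′} → (∀ j → 2 ℕ.* j ℕ.≤ n → f j ≡ f′ j) → short n f ≗ short n f′
short-cong n f≡f′ k = ∑<-cong (suc ⌊ n /2⌋) λ j j≤ → cong (_* (X^ (n ∸ 2 ℕ.* j)) k) (f≡f′ j (2*≤ n j (ℕ.≤-pred j≤)))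

2*suc : ∀ j → 2 ℕ.* suc j ≡ suc (suc (2 ℕ.* j))
2*suc j = cong suc (ℕ.+-suc j (j ℕ.+ 0))

short-step : ∀ n f k → short (suc (suc n)) f k ≡ f 0 * (X^ suc (suc n)) k + short n (f ∘ suc) k
short-step n f k = cong (_+_ (f 0 * (X^ suc (suc n)) k)) (∑<-cong (suc ⌊ n /2⌋) λ j _ →
  cong (λ i → f (suc j) * (X^ (suc (suc n) ∸ i)) k) (2*suc j))

-- Abel summation: f_j is the sum of the differences f_k - f_(k-1) over k ≤ j, and the monomials
-- multiplied by a fixed difference form the all-ones polynomial t_(n-2k).
short-t : ∀ n f m → short n f m ≡ ∑< (suc ⌊ n /2⌋) λ k → - D f k * short (n ∸ 2 ℕ.* k) (λ _ → 1ℤ) m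
short-t zero          f m = cong (_+ 0ℤ) (single (f 0) (1ₚ m))
  where
  single : ∀ a b → a * b ≡ - (0ℤ - a) * (1ℤ * b + 0ℤ)
  single = solve-∀
short-t (suc zero)    f m = cong (_+ 0ℤ) (single (f 0) ((X^ 1) m))
  where
  single : ∀ a b → a * b ≡ - (0ℤ - a) * (1ℤ * b + 0ℤ)
  single = solve-∀
short-t (suc (suc n)) f m = begin
  short (suc (suc n)) f m
    ≡⟨ short-step n f m ⟩
  f 0 * (X^ suc (suc n)) m + short n (f ∘ suc) m
    ≡⟨ cong (_+_ (f 0 * (X^ suc (suc n)) m)) (short-t n (f ∘ suc) m) ⟩
  f 0 * (X^ suc (suc n)) m + (- (0ℤ - f 1) * u n + rest)
    -- The induction hypothesis takes f 1 as the first difference. The missing -f 0 is compensated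
    -- by the term f 0 · u n that completes the monomial x^(n+2) to u (n + 2).
    ≡⟨ regroup (f 0) (f 1) ((X^ suc (suc n)) m) (u n) rest ⟩
  - (0ℤ - f 0) * (1ℤ * (X^ suc (suc n)) m + u n) + (- (f 0 - f 1) * u n + rest)
    ≡⟨ cong (λ z → - (0ℤ - f 0) * z + (- (f 0 - f 1) * u n + rest)) (short-step n (λ _ → 1ℤ) m) ⟨
  - (0ℤ - f 0) * u (suc (suc n)) + (- (f 0 - f 1) * u n + rest)
    ≡⟨ cong (λ z → - (0ℤ - f 0) * u (suc (suc n)) + (- (f 0 - f 1) * u n + z))
         (∑<-cong ⌊ n /2⌋ λ k _ → cong (λ i → - D f (suc (suc k)) * u (suc (suc n) ∸ i)) (sym (2*suc (suc k)))) ⟩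
  ∑< (suc (suc ⌊ n /2⌋)) (λ k → - D f k * u (suc (suc n) ∸ 2 ℕ.* k)) ∎
  where
  u : ℕ → ℤ
  u i = short i (λ _ → 1ℤ) m
  rest : ℤ
  rest = ∑< ⌊ n /2⌋ λ k → - D f (suc (suc k)) * u (n ∸ 2 ℕ.* suc k)
  regroup : ∀ a b x v r → a * x + (- (0ℤ - b) * v + r) ≡ - (0ℤ - a) * (1ℤ * x + v) + (- (a - b) * v + r)
  regroup = solve-∀

t≗ : ∀ n → t (+ n) ≗ short n (λ _ → 1ℤ)
t≗ n k = trans (cong (λ r → short (r ∸ 1) (toricF (boolean (suc n)) Subset.⊤) k) (∣⊤∣≡n (suc n)))
               (short-cong n (BooleanToric.toricF-boolean n) k)

n-2k : ∀ n k → k ℕ.≤ ⌊ n /2⌋ → + n - + 2 * + k ≡ + (n ∸ 2 ℕ.* k)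
n-2k n k k≤ = trans (cong (λ z → + n - z) (sym (ℤ.pos-* 2 k)))
  (trans (ℤ.m-n≡m⊖n n (2 ℕ.* k)) (ℤ.⊖-≥ (2*≤ n k k≤)))

-- For n < 2 the sum is empty, in agreement with t being 0 at negative indices.
∑<-δ : ∀ n m → ∑< ⌊ n /2⌋ (λ k → ⟦ k ℕ.≟ 0 ⟧ * t (+ n - + 2 * + suc k) m) ≡ t (+ n - + 2) m
∑<-δ zero          m = refl
∑<-δ (suc zero)    m = refl
∑<-δ (suc (suc n)) m = trans
  (∑<-single (suc ⌊ n /2⌋) {λ k → ⟦ k ℕ.≟ 0 ⟧ * τ k} 0 ℕ.z<s λ k k≢0 → cong (_* τ k) (⟦⟧-no (k ℕ.≟ 0) k≢0))
  (ℤ.*-identityˡ (τ 0))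
  where
  τ : ℕ → ℤ
  τ k = t (+ suc (suc n) - + 2 * + suc k) m

theorem6p6 : (P : GradedPoset) (n : ℕ) →
    GradedPoset.rank P ≡ suc n →
    Eulerian P →
    DualSimplicial P →
    let h = toricH (dual P) in
    shortToric P ≗
    h 0 · (t (+ n) ⊖ (+ n - + 1) · t (+ n - + 2))
    ⊕ ∑[ i ∈ 1 ⋯ n ∸ 1 ] h i · (∑[ k ∈ 1 ⋯ ⌊ n /2⌋ ]
    (+ ((n ∸ i) C k) * + ((i ∸ 1) C (k ∸ 1)) - + ((n ∸ i ∸ 1) C k) * + (i C (k ∸ 1)))
    · t (+ n - + 2 * + k))
theorem6p6 P n rank≡ eulerian dualSimplicial m = begin
  short (rank ∸ 1) f m
    ≡⟨ cong (λ r → short (r ∸ 1) f m) rank≡ ⟩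
  short n f m
    ≡⟨ short-t n f m ⟩
  ∑< (suc ⌊ n /2⌋) (λ k → - D f k * short (n ∸ 2 ℕ.* k) (λ _ → 1ℤ) m)
    -- In degrees at most n/2 the differences of f are the coefficients of `G 1̂`.
    ≡⟨ ∑<-cong (suc ⌊ n /2⌋) (λ k k≤ → cong₂ _*_
         (-D-toricF-1̂ k (2*≤ n k (ℕ.≤-pred k≤)))
         (sym (trans (cong (_$ m) (cong t (n-2k n k (ℕ.≤-pred k≤)))) (t≗ (n ∸ 2 ℕ.* k) m)))) ⟩
  G 1̂ 0 * t (+ n - + 2 * + 0) m + ∑< ⌊ n /2⌋ (λ k → G 1̂ (suc k) * τ k)
    -- The term k = 0 is h_0 t_n; the exceptional part of the other coefficients becomes -(n - 1)
    -- h_0 t_(n-2).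
    ≡⟨ cong₂ _+_ (cong₂ (λ a i → a * t i m) G-1̂-zero (ℤ.+-identityʳ (+ n)))
         (trans (∑<-cong ⌊ n /2⌋ λ k k< → trans (cong (_* τ k) (split n rank≡ k k<)) (distrib (∑< (n ∸ 1) λ i → h (suc i) * coefficient n (suc i) (suc k)) (h 0) (+ n - + 1) ⟦ k ℕ.≟ 0 ⟧ (τ k)))
                (sum-sub {⌊ n /2⌋} (λ k → A (toℕ k)) (λ k → (h 0 * (+ n - + 1)) * δτ (toℕ k)))) ⟩
  h 0 * t (+ n) m + (∑< ⌊ n /2⌋ A - ∑< ⌊ n /2⌋ (λ k → (h 0 * (+ n - + 1)) * δτ k))
    ≡⟨ cong (λ z → h 0 * t (+ n) m + (∑< ⌊ n /2⌋ A - z)) (trans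
         (sym (*-distribˡ-sum {⌊ n /2⌋} (h 0 * (+ n - + 1)) (δτ ∘ toℕ)))
         (cong ((h 0 * (+ n - + 1)) *_) (∑<-δ n m))) ⟩
  h 0 * t (+ n) m + (∑< ⌊ n /2⌋ A - (h 0 * (+ n - + 1)) * t (+ n - + 2) m)
    ≡⟨ regroup (h 0) (t (+ n) m) (∑< ⌊ n /2⌋ A) (+ n - + 1) (t (+ n - + 2) m) ⟩
  h 0 * (t (+ n) m - (+ n - + 1) * t (+ n - + 2) m) + ∑< ⌊ n /2⌋ A
    ≡⟨ cong (_+_ (h 0 * (t (+ n) m - (+ n - + 1) * t (+ n - + 2) m))) swap ⟩
  h 0 * (t (+ n) m - (+ n - + 1) * t (+ n - + 2) m)
    + ∑< (n ∸ 1) (λ i → h (suc i) * ∑< ⌊ n /2⌋ λ k → coefficient n (suc i) (suc k) * τ k) ∎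
  where
  open GradedPoset P using (rank; 1̂)
  open DualSimplicialEulerian P eulerian dualSimplicial using (G)
  open Combination P n rank≡ eulerian dualSimplicial using (h; -D-toricF-1̂; G-1̂-zero)

  f : Poly
  f = toricF P 1̂

  τ δτ A : ℕ → ℤ
  τ k  = t (+ n - + 2 * + suc k) m
  δτ k = ⟦ k ℕ.≟ 0 ⟧ * τ k
  A k  = ∑< (n ∸ 1) (λ i → h (suc i) * coefficient n (suc i) (suc k)) * τ k

  distrib : ∀ a b c d x → (a - b * (c * d)) * x ≡ a * x - (b * c) * (d * x)
  distrib = solve-∀

  regroup : ∀ a x s c y → a * x + (s - (a * c) * y) ≡ a * (x - c * y) + s
  regroup = solve-∀

  split : ∀ n (rank≡ : GradedPoset.rank P ≡ suc n) k → k ℕ.< ⌊ n /2⌋ → G 1̂ (suc k) ≡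
          ∑< (n ∸ 1) (λ i → h (suc i) * coefficient n (suc i) (suc k)) - h 0 * ((+ n - + 1) * ⟦ k ℕ.≟ 0 ⟧)
  -- For n = 0 there is no k below ⌊n/2⌋.
  split (suc n) rank≡ k _ = G-1̂-suc P n rank≡ eulerian dualSimplicial k

  swap : ∑< ⌊ n /2⌋ A ≡ ∑< (n ∸ 1) λ i → h (suc i) * ∑< ⌊ n /2⌋ λ k → coefficient n (suc i) (suc k) * τ k
  swap = begin
    ∑< ⌊ n /2⌋ A
      ≡⟨ ∑<-cong ⌊ n /2⌋ (λ k _ → sym (sum-*ʳ {n ∸ 1} (λ i → h (suc (toℕ i)) * coefficient n (suc (toℕ i)) (suc k)) (τ k))) ⟩
    ∑< ⌊ n /2⌋ (λ k → ∑< (n ∸ 1) λ i → h (suc i) * coefficient n (suc i) (suc k) * τ k)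
      ≡⟨ ∑<-cong ⌊ n /2⌋ (λ k _ → ∑<-cong (n ∸ 1) λ i _ → ℤ.*-assoc (h (suc i)) (coefficient n (suc i) (suc k)) (τ k)) ⟩
    ∑< ⌊ n /2⌋ (λ k → ∑< (n ∸ 1) λ i → h (suc i) * (coefficient n (suc i) (suc k) * τ k))
      ≡⟨ sum-swap {n ∸ 1} {⌊ n /2⌋} (λ i → h (suc (toℕ i))) (λ i k → coefficient n (suc (toℕ i)) (suc (toℕ k)) * τ (toℕ k)) ⟨
    ∑< (n ∸ 1) (λ i → h (suc i) * ∑< ⌊ n /2⌋ λ k → coefficient n (suc i) (suc k) * τ k) ∎
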